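{- Let $n\ge 2$. Among all phenylene chains with $n$ hexagons and $n-1$ squares, the helicene phenylene chain $H_n=G(0,0,\ldots,0)$ has the minimum Kirchhoff index; that is, for every $w\in\{0,1,2\}^{n-2}$, $$K\!f(H_n)\le K\!f(G(w)).$$
   Context: All graphs are simple and connected. For vertices $u,v$ of a connected graph $G$, the resistance distance $r_G(u,v)$ is the effective resistance between $u$ and $v$ in the electrical network obtained from $G$ by replacing each edge with a unit resistor. The Kirchhoff index is $K\!f(G)=\sum_{\{u,v\}\subseteq V(G)} r_G(u,v)$, the sum being over all unordered pairs of distinct vertices. Phenylene chains with $n$ hexagons and $n-1$ squares ($n\ge 2$) are represented as the (abstract) graphs $G(w)$, $w=(w_1,\ldots,w_{n-2})\in\{0,1,2\}^{n-2}$, constructed as follows. Let $Q_{2n-1}$ be the ladder graph with $2n-1$ squares: it has top vertices $t_1,\ldots,t_{2n}$, bottom vertices $s_1,\ldots,s_{2n}$, and edges $t_jt_{j+1}$ and $s_js_{j+1}$ for $1\le j\le 2n-1$, together with $t_js_j$ for $1\le j\le 2n$. Its $j$-th square $S_j$ is the 4-cycle $t_jt_{j+1}s_{j+1}s_j$, with top edge $t_jt_{j+1}$ and bottom edge $s_js_{j+1}$. "Adding $m$ vertices to an edge" means subdividing that edge $m$ times, i.e. replacing it by a path with $m$ new internal vertices ($m=0$ leaves the edge unchanged). The graph $G(w)$ is obtained from $Q_{2n-1}$ by adding two vertices to each odd-indexed square $S_1,S_3,\ldots,S_{2n-1}$, turning each of them into a hexagon, as follows: - for the two end squares $S_1$ and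 $S_{2n-1}$, two vertices are added to the bottom edge; - for $1\le i\le n-2$, in the square $S_{2i+1}$, $w_i$ vertices are added to the top edge and $2-w_i$ vertices are added to the bottom edge. The even-indexed squares are left unchanged. The helicene phenylene chain is $H_n=G(0,0,\ldots,0)$ (with $n-2$ zeros; for $n=2$ the vector $w$ is empty). -}

module Defs where

open import Data.Bool.Base using (if_then_else_)
open import Data.Empty using (⊥)
open import Data.Fin.Base using (Fin; zero; suc; toℕ; fromℕ; inject₁)
open import Data.Fin.Induction using (<-weakInduction)
open import Data.Fin.Properties as Fin using ()
open import Data.Fin.Relation.Unary.Top using (View; view; ‵fromℕ; ‵inject₁; view-fromℕ; view-inject₁)
open import Data.List.Base using (List; []; _∷_; map; foldr; _++_; concatMap; allFin)
open import Data.List.Membership.Propositional using (_∈_)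
open import Data.List.Membership.Propositional.Properties using (∈-map⁺; ∈-map⁻; ∈-++⁺ˡ; ∈-++⁺ʳ; ∈-concatMap⁺; ∈-concatMap⁻; ∈-allFin)
open import Data.List.Relation.Unary.All as All using (All; []; _∷_)
open import Data.List.Relation.Unary.Any as Any using (here; there)
open import Data.List.Relation.Unary.AllPairs.Core using ([]; _∷_)
open import Data.List.Relation.Unary.Unique.Propositional using (Unique)
open import Data.List.Relation.Unary.Unique.Propositional.Properties using (map⁺; ++⁺; allFin⁺)
open import Data.Nat.Base using (ℕ; zero; suc; _∸_) renaming (_+_ to _ℕ+_; _*_ to _ℕ*_)
open import Data.Product.Base using (Σ; ∃; _×_; _,_; proj₁; proj₂)
open import Data.Product.Properties using (≡-dec)
open import Data.Rational.Base using (ℚ; 0ℚ; 1ℚ; _+_; _*_; _-_; -_; 1/_; _≤_; NonZero; nonNegative; nonPositive)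
open import Data.Rational.Properties using (+-identityʳ; +-mono-≤; *-inverseˡ; *-identityˡ; pos+nonNeg⇒pos; pos⇒nonZero; nonNegative⁻¹; nonNeg*nonNeg⇒nonNeg; nonPos*nonPos⇒nonPos; ≤-total) renaming (≤-reflexive to ℚ≤-reflexive)
open import Data.Rational.Solver using (module +-*-Solver)
open import Data.Sum.Base using (_⊎_; inj₁; inj₂; swap)
open import Data.Sum.Properties using (inj₁-injective; inj₂-injective) renaming (≡-dec to ⊎-≡-dec)
open import Data.Vec.Base using (Vec; []; _∷_; lookup; replicate)
open import Relation.Binary.Construct.Closure.ReflexiveTransitive using (Star; ε; _◅_; _◅◅_; kleisliStar; reverse)
open import Relation.Binary.Definitions using (DecidableEquality)
open import Relation.Binary.PropositionalEquality using (_≡_; _≢_; refl; sym; trans; cong; cong₂; subst; module ≡-Reasoning)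
open import Relation.Nullary.Decidable using (yes; no; does; dec-true; dec-false)
open import Relation.Nullary.Negation.Core using (contradiction)

record Finite (A : Set) : Set where
  field
    elements : List A
    complete : ∀ x → x ∈ elements
    unique   : Unique elements
    _≟_      : DecidableEquality A

∑ : {A : Set} → List A → (A → ℚ) → ℚ
∑ xs f = foldr (λ x acc → f x + acc) 0ℚ xs

-- On a repetition-free list this takes each unordered pair of distinct
-- entries exactly once.
∑-pairs : {A : Set} → List A → (A → A → ℚ) → ℚ
∑-pairs []       f = 0ℚ
∑-pairs (x ∷ xs) f = ∑ xs (f x) + ∑-pairs xs f

-- Finite simple connected graphs.  An edge is named, and its two ends are
-- listed in an arbitrary order; `noParallel` says that edges with the same
-- unordered pair of ends coincide.
record Graph : Set₁ where
  field
    V E        : Set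
    finiteV    : Finite V
    finiteE    : Finite E
    end₁ end₂  : E → V
    loopless   : ∀ e → end₁ e ≢ end₂ e
    noParallel : ∀ e f →
                 (end₁ e ≡ end₁ f × end₂ e ≡ end₂ f) ⊎ (end₁ e ≡ end₂ f × end₂ e ≡ end₁ f) →
                 e ≡ f

  Adjacent : V → V → Set
  Adjacent u v = ∃ λ e → (end₁ e ≡ u × end₂ e ≡ v) ⊎ (end₁ e ≡ v × end₂ e ≡ u)

  field
    connected : ∀ u v → Star Adjacent u v

  open Finite finiteV public using () renaming (elements to vertices; _≟_ to _≟ᵛ_)
  open Finite finiteE public using () renaming (elements to edges; _≟_ to _≟ᵉ_)

  δ : V → V → ℚ
  δ u x = if does (u ≟ᵛ x) then 1ℚ else 0ℚ

  -- Ohm's law for a unit resistor: the current from end₁ e to end₂ e.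
  current : (V → ℚ) → E → ℚ
  current φ e = φ (end₁ e) - φ (end₂ e)

  -- The total current leaving x along the edges in es.
  outflow : List E → (V → ℚ) → V → ℚ
  outflow es φ x = ∑ es (λ e → current φ e * (δ (end₁ e) x - δ (end₂ e) x))

  -- Potentials when a unit current is injected at u and extracted at v.
  -- (The equations have rational coefficients, so rational potentials exist
  -- and real ones would give the same differences.)
  record UnitFlow (u v : V) : Set where
    field
      potential  : V → ℚ
      currentLaw : ∀ x → outflow edges potential x ≡ δ u x - δ v x

module Existence (G : Graph) where
  open Graph G
  open +-*-Solver

  record Solution (es : List E) (b : V → ℚ) : Set where
    constructor _,ₛ_
    field
      φ      : V → ℚ
      solves : ∀ x → outflow es φ x ≡ b x

  δ-refl : ∀ u → δ u u ≡ 1ℚ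
  δ-refl u with u ≟ᵛ u
  ... | yes _  = refl
  ... | no u≢u = contradiction refl u≢u

  δ-≢ : ∀ {u x} → u ≢ x → δ u x ≡ 0ℚ
  δ-≢ {u} {x} u≢x with u ≟ᵛ x
  ... | yes u≡x = contradiction u≡x u≢x
  ... | no _    = refl

  outflow-linear : ∀ es φ k ψ x →
    outflow es (λ y → φ y + k * ψ y) x ≡ outflow es φ x + k * outflow es ψ x
  outflow-linear []       φ k ψ x =
    solve 1 (λ k → con 0ℚ := con 0ℚ :+ k :* con 0ℚ) refl k
  outflow-linear (e ∷ es) φ k ψ x =
    trans
      (cong (((φ (end₁ e) + k * ψ (end₁ e)) - (φ (end₂ e) + k * ψ (end₂ e)))
              * (δ (end₁ e) x - δ (end₂ e) x) +_)
            (outflow-linear es φ k ψ x))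
      (solve 8 (λ a b c d k s p q →
          ((a :+ k :* c) :- (b :+ k :* d)) :* s :+ (p :+ k :* q)
            := ((a :- b) :* s :+ p) :+ k :* ((c :- d) :* s :+ q)) refl
        (φ (end₁ e)) (φ (end₂ e)) (ψ (end₁ e)) (ψ (end₂ e)) k
        (δ (end₁ e) x - δ (end₂ e) x) (outflow es φ x) (outflow es ψ x))

  outflow-constant : ∀ es φ x → (∀ {e} → e ∈ es → φ (end₁ e) ≡ φ (end₂ e)) →
                     outflow es φ x ≡ 0ℚ
  outflow-constant []       φ x c = refl
  outflow-constant (e ∷ es) φ x c
    rewrite c (here refl) | outflow-constant es φ x (λ p → c (there p)) =
    solve 2 (λ a s → (a :- a) :* s :+ con 0ℚ := con 0ℚ) refl
      (φ (end₂ e)) (δ (end₁ e) x - δ (end₂ e) x)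

  combine : ∀ {es b c} k → Solution es b → Solution es c → Solution es (λ x → b x + k * c x)
  combine {es} k (φ ,ₛ p) (ψ ,ₛ q) =
    (λ y → φ y + k * ψ y) ,ₛ
    λ x → trans (outflow-linear es φ k ψ x) (cong₂ (λ s t → s + k * t) (p x) (q x))

  respect : ∀ {es b c} → (∀ x → b x ≡ c x) → Solution es b → Solution es c
  respect b≡c (φ ,ₛ p) = φ ,ₛ λ x → trans (p x) (b≡c x)

  zeroSolution : ∀ es → Solution es (λ _ → 0ℚ)
  zeroSolution es = (λ _ → 0ℚ) ,ₛ λ x → outflow-constant es (λ _ → 0ℚ) x (λ _ → refl)

  scaled : ∀ {es} {d : V → ℚ} k r → r * (1ℚ + k) ≡ 1ℚ →
           Solution es (λ x → k * d x + d x) → Solution es d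
  scaled {es} {d} k r inv sol = respect
    (λ x → trans
      (solve 3 (λ r k d → con 0ℚ :+ r :* (k :* d :+ d) := (r :* (con 1ℚ :+ k)) :* d) refl r k (d x))
      (trans (cong (_* d x) inv) (*-identityˡ (d x))))
    (combine r (zeroSolution es) sol)

  ∑-linear : ∀ (xs : List V) k (f g h : V → ℚ) →
    ∑ xs (λ x → f x * (k * g x + h x)) ≡ k * ∑ xs (λ x → f x * g x) + ∑ xs (λ x → f x * h x)
  ∑-linear []       k f g h = solve 1 (λ k → con 0ℚ := k :* con 0ℚ :+ con 0ℚ) refl k
  ∑-linear (x ∷ xs) k f g h = trans (cong (f x * (k * g x + h x) +_) (∑-linear xs k f g h))
    (solve 6 (λ f g h k s t → f :* (k :* g :+ h) :+ (k :* s :+ t)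
        := k :* (f :* g :+ s) :+ (f :* h :+ t)) refl
      (f x) (g x) (h x) k (∑ xs (λ x → f x * g x)) (∑ xs (λ x → f x * h x)))

  ∑-cong : ∀ (xs : List V) {f g : V → ℚ} → (∀ x → f x ≡ g x) → ∑ xs f ≡ ∑ xs g
  ∑-cong []       eq = refl
  ∑-cong (x ∷ xs) eq = cong₂ _+_ (eq x) (∑-cong xs eq)

  ∑-δ-∉ : ∀ (f : V → ℚ) u xs → All (u ≢_) xs → ∑ xs (λ x → f x * δ u x) ≡ 0ℚ
  ∑-δ-∉ f u []       []       = refl
  ∑-δ-∉ f u (x ∷ xs) (p ∷ ps) rewrite δ-≢ p | ∑-δ-∉ f u xs ps =
    solve 1 (λ a → a :* con 0ℚ :+ con 0ℚ := con 0ℚ) refl (f x)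

  ∑-δ-∈ : ∀ (f : V → ℚ) u xs → Unique xs → u ∈ xs → ∑ xs (λ x → f x * δ u x) ≡ f u
  ∑-δ-∈ f u (x ∷ xs) (p ∷ ps) (here refl) rewrite δ-refl u | ∑-δ-∉ f u xs p =
    solve 1 (λ a → a :* con 1ℚ :+ con 0ℚ := a) refl (f u)
  ∑-δ-∈ f u (x ∷ xs) (p ∷ ps) (there u∈xs)
    rewrite δ-≢ {u} {x} (λ u≡x → All.lookup p u∈xs (sym u≡x)) | ∑-δ-∈ f u xs ps u∈xs =
    solve 2 (λ a b → a :* con 0ℚ :+ b := b) refl (f x) (f u)

  ∑-δ : ∀ (f : V → ℚ) u → ∑ vertices (λ x → f x * δ u x) ≡ f u
  ∑-δ f u = ∑-δ-∈ f u vertices (Finite.unique finiteV) (Finite.complete finiteV u)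

  ∑-δ-δ : ∀ (f : V → ℚ) u v → ∑ vertices (λ x → f x * (δ u x - δ v x)) ≡ f u - f v
  ∑-δ-δ f u v = begin
    ∑ vertices (λ x → f x * (δ u x - δ v x))
      ≡⟨ ∑-cong vertices (λ x → solve 3 (λ f a b → f :* (a :- b) := f :* (:- con 1ℚ :* b :+ a))
           refl (f x) (δ u x) (δ v x)) ⟩
    ∑ vertices (λ x → f x * (- 1ℚ * δ v x + δ u x))
      ≡⟨ ∑-linear vertices (- 1ℚ) f (δ v) (δ u) ⟩
    - 1ℚ * ∑ vertices (λ x → f x * δ v x) + ∑ vertices (λ x → f x * δ u x)
      ≡⟨ cong₂ (λ a b → - 1ℚ * a + b) (∑-δ f v) (∑-δ f u) ⟩
    - 1ℚ * f v + f u
      ≡⟨ solve 2 (λ a b → :- con 1ℚ :* b :+ a := a :- b) refl (f u) (f v) ⟩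
    f u - f v ∎
    where open ≡-Reasoning

  square≥0 : ∀ q → 0ℚ ≤ q * q
  square≥0 q with ≤-total 0ℚ q
  ... | inj₁ 0≤q = nonNegative⁻¹ (q * q) {{nonNeg*nonNeg⇒nonNeg q {{nonNegative 0≤q}} q {{nonNegative 0≤q}}}}
  ... | inj₂ q≤0 = nonNegative⁻¹ (q * q) {{nonPos*nonPos⇒nonPos q {{nonPositive q≤0}} q {{nonPositive q≤0}}}}

  energy≥0 : ∀ es φ → 0ℚ ≤ ∑ vertices (λ x → φ x * outflow es φ x)
  energy≥0 []       φ = ℚ≤-reflexive (sym (go vertices))
    where
    go : ∀ xs → ∑ xs (λ x → φ x * 0ℚ) ≡ 0ℚ
    go []       = refl
    go (x ∷ xs) rewrite go xs = solve 1 (λ a → a :* con 0ℚ :+ con 0ℚ := con 0ℚ) refl (φ x)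
  energy≥0 (e ∷ es) φ = subst (0ℚ ≤_) (sym eq) (+-mono-≤ (square≥0 (current φ e)) (energy≥0 es φ))
    where
    eq : ∑ vertices (λ x → φ x * outflow (e ∷ es) φ x)
         ≡ current φ e * current φ e + ∑ vertices (λ x → φ x * outflow es φ x)
    eq = trans (∑-linear vertices (current φ e) φ _ (outflow es φ))
               (cong (λ q → current φ e * q + _) (∑-δ-δ φ (end₁ e) (end₂ e)))

  drop≥0 : ∀ es φ u v → (∀ x → outflow es φ x ≡ δ u x - δ v x) → 0ℚ ≤ φ u - φ v
  drop≥0 es φ u v p = subst (0ℚ ≤_)
    (trans (∑-cong vertices (λ x → cong (φ x *_) (p x))) (∑-δ-δ φ u v)) (energy≥0 es φ)

  -- The labels name the connected components of the spanning subgraph with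
  -- edge set es.
  record Components (es : List E) : Set where
    field
      label : V → V
      const : ∀ {e} → e ∈ es → label (end₁ e) ≡ label (end₂ e)
      solve-within : ∀ u v → label u ≡ label v → Solution es (λ x → δ u x - δ v x)

  module Step (e : E) (es : List E) (C : Components es) where
    open Components C
    a b : V
    a = end₁ e
    b = end₂ e

    joined : label a ≡ label b → Solution (e ∷ es) (λ x → δ a x - δ b x)
    joined same = scaled k (1/ (1ℚ + k)) (*-inverseˡ (1ℚ + k))
      (ψ ,ₛ λ x → cong (k * (δ a x - δ b x) +_) (q x))
      where
      ψ : V → ℚ
      ψ = Solution.φ (solve-within a b same)
      q : ∀ x → outflow es ψ x ≡ δ a x - δ b x
      q = Solution.solves (solve-within a b same)
      k : ℚ
      k = ψ a - ψ b
      instance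
        1+k≢0 : NonZero (1ℚ + k)
        1+k≢0 = pos⇒nonZero (1ℚ + k) {{pos+nonNeg⇒pos 1ℚ k {{nonNegative (drop≥0 es ψ a b q)}}}}

    bridge : label a ≢ label b → Solution (e ∷ es) (λ x → δ a x - δ b x)
    bridge differ = χ ,ₛ λ x →
      trans (cong₂ (λ s t → s * (δ a x - δ b x) + t)
              (cong₂ _-_ (δ-refl (label a)) (δ-≢ differ))
              (outflow-constant es χ x (λ p → cong (δ (label a)) (const p))))
            (trans (+-identityʳ _) (*-identityˡ _))
      where
      χ : V → ℚ
      χ y = δ (label a) (label y)

    extend : ∀ {c} → Solution (e ∷ es) (λ x → δ a x - δ b x) →
             Solution es c → Solution (e ∷ es) c
    extend {c} new (φ ,ₛ p) = respect
      (λ x → solve 3 (λ k d c → (k :* d :+ c) :+ :- k :* d := c) refl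
        (current φ e) (δ a x - δ b x) (c x))
      (combine (- current φ e) (φ ,ₛ λ x → cong (current φ e * (δ a x - δ b x) +_) (p x)) new)

    keep : label a ≡ label b → Components (e ∷ es)
    keep same = record
      { label = label
      ; const = λ { (here refl) → same ; (there p) → const p }
      ; solve-within = λ u v eq → extend (joined same) (solve-within u v eq)
      }

    merge : label a ≢ label b → Components (e ∷ es)
    merge differ = record
      { label = label′
      ; const = λ { (here refl) → trans at-a (sym at-b)
                  ; (there p) → cong (λ l → if does (l ≟ᵛ label b) then label a else l) (const p) }
      ; solve-within = within
      }
      where
      label′ : V → V
      label′ y = if does (label y ≟ᵛ label b) then label a else label y

      at-a : label′ a ≡ label a
      at-a rewrite dec-false (label a ≟ᵛ label b) differ = refl

      at-b : label′ b ≡ label a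
      at-b rewrite dec-true (label b ≟ᵛ label b) refl = refl

      new = bridge differ
      old : ∀ u v → label u ≡ label v → Solution (e ∷ es) (λ x → δ u x - δ v x)
      old u v eq = extend new (solve-within u v eq)

      within : ∀ u v → label′ u ≡ label′ v → Solution (e ∷ es) (λ x → δ u x - δ v x)
      within u v eq with label u ≟ᵛ label b | label v ≟ᵛ label b
      ... | yes p | yes q = old u v (trans p (sym q))
      ... | no _  | no _  = old u v eq
      ... | yes p | no _  = respect
        (λ x → solve 4 (λ u v a b → ((u :- b) :+ :- con 1ℚ :* (a :- b)) :+ con 1ℚ :* (a :- v) := u :- v)
          refl (δ u x) (δ v x) (δ a x) (δ b x))
        (combine 1ℚ (combine (- 1ℚ) (old u b p) new) (old a v eq))
      ... | no _  | yes q = respect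
        (λ x → solve 4 (λ u v a b → ((u :- a) :+ con 1ℚ :* (a :- b)) :+ con 1ℚ :* (b :- v) := u :- v)
          refl (δ u x) (δ v x) (δ a x) (δ b x))
        (combine 1ℚ (combine 1ℚ (old u a eq) new) (old b v (sym q)))

    extended : Components (e ∷ es)
    extended with label a ≟ᵛ label b
    ... | yes p = keep p
    ... | no ¬p = merge ¬p

  components : ∀ es → Components es
  components []       = record
    { label = λ y → y
    ; const = λ ()
    ; solve-within = λ { u .u refl → respect
        (λ x → solve 1 (λ a → con 0ℚ := a :- a) refl (δ u x)) (zeroSolution []) }
    }
  components (e ∷ es) = Step.extended e es (components es)

  unitFlow-exists : ∀ u v → UnitFlow u v
  unitFlow-exists u v = record
    { potential = Solution.φ sol ; currentLaw = Solution.solves sol }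
    where
    open Components (components edges)
    along : ∀ {x y} → Star Adjacent x y → label x ≡ label y
    along ε = refl
    along ((e , inj₁ (refl , refl)) ◅ p) =
      trans (const (Finite.complete finiteE e)) (along p)
    along ((e , inj₂ (refl , refl)) ◅ p) =
      trans (sym (const (Finite.complete finiteE e))) (along p)
    sol = solve-within u v (along (connected u v))

unitFlow : (G : Graph) (u v : Graph.V G) → Graph.UnitFlow G u v
unitFlow G = Existence.unitFlow-exists G

-- The voltage across u and v under a unit current.  Potentials for a given
-- (u , v) differ by a constant only, so the choice made by unitFlow is immaterial.
resistance : (G : Graph) → Graph.V G → Graph.V G → ℚ
resistance G u v = potential u - potential v
  where open Graph.UnitFlow (unitFlow G u v)

Kf : Graph → ℚ
Kf G = ∑-pairs (Graph.vertices G) (resistance G)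

finite-Fin : ∀ n → Finite (Fin n)
finite-Fin n = record
  { elements = allFin n ; complete = ∈-allFin ; unique = allFin⁺ n ; _≟_ = Fin._≟_ }

finite-⊎ : {A B : Set} → Finite A → Finite B → Finite (A ⊎ B)
finite-⊎ FA FB = record
  { elements = map inj₁ A.elements ++ map inj₂ B.elements
  ; complete = λ { (inj₁ x) → ∈-++⁺ˡ (∈-map⁺ inj₁ (A.complete x))
                 ; (inj₂ y) → ∈-++⁺ʳ _ (∈-map⁺ inj₂ (B.complete y)) }
  ; unique   = ++⁺ (map⁺ inj₁-injective A.unique) (map⁺ inj₂-injective B.unique) disjoint
  ; _≟_      = ⊎-≡-dec A._≟_ B._≟_
  }
  where
  module A = Finite FA
  module B = Finite FB
  disjoint : ∀ {z} → z ∈ map inj₁ A.elements × z ∈ map inj₂ B.elements → ⊥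
  disjoint (p , q) with ∈-map⁻ inj₁ p | ∈-map⁻ inj₂ q
  ... | _ , _ , refl | _ , _ , ()

finite-Σ : {A : Set} {B : A → Set} → Finite A → (∀ x → Finite (B x)) → Finite (Σ A B)
finite-Σ {A} {B} FA FB = record
  { elements = concatMap fibre A.elements
  ; complete = λ { (x , y) → ∈-concatMap⁺ fibre
                     (Any.map (λ { refl → ∈-map⁺ (x ,_) (Finite.complete (FB x) y) }) (A.complete x)) }
  ; unique   = unique-concatMap A.elements A.unique
  ; _≟_      = ≡-dec A._≟_ (λ {x} → Finite._≟_ (FB x))
  }
  where
  module A = Finite FA
  fibre : A → List (Σ A B)
  fibre x = map (x ,_) (Finite.elements (FB x))

  base : ∀ {z} x → z ∈ fibre x → x ≡ proj₁ z
  base x p with ∈-map⁻ (x ,_) p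
  ... | _ , _ , refl = refl

  unique-concatMap : ∀ xs → Unique xs → Unique (concatMap fibre xs)
  unique-concatMap []       []       = []
  unique-concatMap (x ∷ xs) (p ∷ ps) =
    ++⁺ (map⁺ (λ { refl → refl }) (Finite.unique (FB x))) (unique-concatMap xs ps)
      λ { {z} (q , r) → All.lookup p
            (Any.map (λ {y} z∈ → sym (base y z∈)) (∈-concatMap⁻ fibre {xs = xs} r)) (base x q) }

-- The ladder with L squares.  Indices start at 0: top j and bottom j are
-- t_{j+1} and s_{j+1}, and topEdge j, bottomEdge j are the sides of the square S_{j+1}.
LadderV LadderE : ℕ → Set
LadderV L = Fin (suc L) ⊎ Fin (suc L)
LadderE L = Fin L ⊎ (Fin L ⊎ Fin (suc L))

pattern top j    = inj₁ j
pattern bottom j = inj₂ j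

pattern topEdge j    = inj₁ j
pattern bottomEdge j = inj₂ (inj₁ j)
pattern rung j       = inj₂ (inj₂ j)

ladderEnd₁ ladderEnd₂ : ∀ {L} → LadderE L → LadderV L
ladderEnd₁ (topEdge j)    = top (inject₁ j)
ladderEnd₁ (bottomEdge j) = bottom (inject₁ j)
ladderEnd₁ (rung j)       = top j
ladderEnd₂ (topEdge j)    = top (suc j)
ladderEnd₂ (bottomEdge j) = bottom (suc j)
ladderEnd₂ (rung j)       = bottom j

private
  inject₁≢suc : ∀ {n} (i : Fin n) → inject₁ i ≢ suc i
  inject₁≢suc zero    ()
  inject₁≢suc (suc i) eq = inject₁≢suc i (Fin.suc-injective eq)

  no-swap : ∀ {n} (i j : Fin n) → inject₁ i ≡ suc j → suc i ≡ inject₁ j → {A : Set} → A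
  no-swap (suc i) (suc j) p q = no-swap i j (Fin.suc-injective p) (Fin.suc-injective q)

  ladder-loopless : ∀ {L} (e : LadderE L) → ladderEnd₁ e ≢ ladderEnd₂ e
  ladder-loopless (topEdge j)    eq = inject₁≢suc j (inj₁-injective eq)
  ladder-loopless (bottomEdge j) eq = inject₁≢suc j (inj₂-injective eq)
  ladder-loopless (rung j)       ()

  ladder-noParallel : ∀ {L} (e f : LadderE L) →
    (ladderEnd₁ e ≡ ladderEnd₁ f × ladderEnd₂ e ≡ ladderEnd₂ f) ⊎
    (ladderEnd₁ e ≡ ladderEnd₂ f × ladderEnd₂ e ≡ ladderEnd₁ f) → e ≡ f
  ladder-noParallel (topEdge i) (topEdge j) (inj₁ (_ , q)) =
    cong inj₁ (Fin.suc-injective (inj₁-injective q))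
  ladder-noParallel (topEdge i) (topEdge j) (inj₂ (p , q)) =
    no-swap i j (inj₁-injective p) (inj₁-injective q)
  ladder-noParallel (topEdge i) (bottomEdge j) (inj₁ (() , _))
  ladder-noParallel (topEdge i) (bottomEdge j) (inj₂ (() , _))
  ladder-noParallel (topEdge i) (rung j) (inj₁ (_ , ()))
  ladder-noParallel (topEdge i) (rung j) (inj₂ (() , _))
  ladder-noParallel (bottomEdge i) (topEdge j) (inj₁ (() , _))
  ladder-noParallel (bottomEdge i) (topEdge j) (inj₂ (() , _))
  ladder-noParallel (bottomEdge i) (bottomEdge j) (inj₁ (_ , q)) =
    cong (λ k → bottomEdge k) (Fin.suc-injective (inj₂-injective q))
  ladder-noParallel (bottomEdge i) (bottomEdge j) (inj₂ (p , q)) =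
    no-swap i j (inj₂-injective p) (inj₂-injective q)
  ladder-noParallel (bottomEdge i) (rung j) (inj₁ (() , _))
  ladder-noParallel (bottomEdge i) (rung j) (inj₂ (_ , ()))
  ladder-noParallel (rung i) (topEdge j) (inj₁ (_ , ()))
  ladder-noParallel (rung i) (topEdge j) (inj₂ (_ , ()))
  ladder-noParallel (rung i) (bottomEdge j) (inj₁ (() , _))
  ladder-noParallel (rung i) (bottomEdge j) (inj₂ (() , _))
  ladder-noParallel (rung i) (rung j) (inj₁ (p , _)) = cong (λ k → rung k) (inj₁-injective p)
  ladder-noParallel (rung i) (rung j) (inj₂ (() , _))

  LadderAdjacent : ∀ {L} → LadderV L → LadderV L → Set
  LadderAdjacent u v = ∃ λ e →
    (ladderEnd₁ e ≡ u × ladderEnd₂ e ≡ v) ⊎ (ladderEnd₁ e ≡ v × ladderEnd₂ e ≡ u)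

  ladder-from-origin : ∀ {L} (v : LadderV L) → Star LadderAdjacent (top zero) v
  ladder-from-origin (top j) = <-weakInduction (λ i → Star LadderAdjacent (top zero) (top i)) ε
    (λ i p → p ◅◅ ((topEdge i , inj₁ (refl , refl)) ◅ ε)) j
  ladder-from-origin (bottom j) =
    ladder-from-origin (top j) ◅◅ ((rung j , inj₁ (refl , refl)) ◅ ε)

ladder : ℕ → Graph
ladder L = record
  { V          = LadderV L
  ; E          = LadderE L
  ; finiteV    = finite-⊎ (finite-Fin _) (finite-Fin _)
  ; finiteE    = finite-⊎ (finite-Fin _) (finite-⊎ (finite-Fin _) (finite-Fin _))
  ; end₁       = ladderEnd₁
  ; end₂       = ladderEnd₂
  ; loopless   = ladder-loopless
  ; noParallel = ladder-noParallel
  ; connected  = λ u v → reverse (λ { (e , p) → e , swap p }) (ladder-from-origin u)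
                         ◅◅ ladder-from-origin v
  }

-- Each edge e is replaced by the path
--   end₁ e — (e , 0) — ⋯ — (e , m e - 1) — end₂ e,
-- whose consecutive edges are numbered 0, …, m e.
module Subdivision (G : Graph) (m : Graph.E G → ℕ) where
  open Graph G

  V′ E′ : Set
  V′ = V ⊎ Σ E (λ e → Fin (m e))
  E′ = Σ E (λ e → Fin (suc (m e)))

  end₁′ : E′ → V′
  end₁′ (e , zero)  = inj₁ (end₁ e)
  end₁′ (e , suc i) = inj₂ (e , i)

  nextVertex : ∀ e {i : Fin (suc (m e))} → View i → V′
  nextVertex e ‵fromℕ       = inj₁ (end₂ e)
  nextVertex e (‵inject₁ i) = inj₂ (e , i)

  end₂′ : E′ → V′
  end₂′ (e , i) = nextVertex e (view i)

  private
    end₂′-inj₁ : ∀ e i {v} → end₂′ (e , i) ≡ inj₁ v → v ≡ end₂ e × i ≡ fromℕ (m e)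
    end₂′-inj₁ e i eq with view i
    end₂′-inj₁ e _ refl | ‵fromℕ = refl , refl

    end₂′-inj₂ : ∀ e i {f j} → end₂′ (e , i) ≡ inj₂ (f , j) →
                 Σ (e ≡ f) λ e≡f → i ≡ inject₁ (subst (λ g → Fin (m g)) (sym e≡f) j)
    end₂′-inj₂ e i eq with view i
    end₂′-inj₂ e _ refl | ‵inject₁ j = refl , refl

    loopless′ : ∀ e → end₁′ e ≢ end₂′ e
    loopless′ (e , zero)  eq = loopless e (proj₁ (end₂′-inj₁ e zero (sym eq)))
    loopless′ (e , suc i) eq with end₂′-inj₂ e (suc i) (sym eq)
    ... | refl , p = inject₁≢suc i (sym p)

    noParallel′ : ∀ e f →
      (end₁′ e ≡ end₁′ f × end₂′ e ≡ end₂′ f) ⊎ (end₁′ e ≡ end₂′ f × end₂′ e ≡ end₁′ f) → e ≡ f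
    noParallel′ (e , suc i) (f , suc j) (inj₁ (refl , _)) = refl
    noParallel′ (e , zero) (f , zero) (inj₁ (p , q)) with end₂′ (f , zero) in r
    ... | inj₁ v with end₂′-inj₁ e zero q | end₂′-inj₁ f zero r
    ...   | refl , _ | p₂ , _ with noParallel e f (inj₁ (inj₁-injective p , p₂))
    ...     | refl = refl
    noParallel′ (e , zero) (f , zero) (inj₁ (p , q)) | inj₂ (g , k)
      with end₂′-inj₂ e zero q | end₂′-inj₂ f zero r
    ... | refl , _ | refl , _ = refl
    noParallel′ (e , zero) (f , zero) (inj₂ (p , q))
      with end₂′-inj₁ f zero (sym p) | end₂′-inj₁ e zero q
    ... | p₁ , _ | q₁ , _ with noParallel e f (inj₂ (p₁ , sym q₁))
    ...   | refl = refl
    noParallel′ (e , zero) (f , suc j) (inj₂ (p , q))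
      with end₂′-inj₂ e zero q | end₂′-inj₁ f (suc j) (sym p)
    ... | refl , _ | p₁ , _ = contradiction p₁ (loopless e)
    noParallel′ (e , suc i) (f , zero) (inj₂ (p , q))
      with end₂′-inj₂ f zero (sym p) | end₂′-inj₁ e (suc i) q
    ... | refl , _ | q₁ , _ = contradiction q₁ (loopless e)
    noParallel′ (e , suc i) (f , suc j) (inj₂ (p , q))
      with end₂′-inj₂ f (suc j) (sym p)
    ... | refl , p₁ with end₂′-inj₂ e (suc i) q
    ...   | refl , q₁ = no-swap i j (sym p₁) q₁

    Adjacent′ : V′ → V′ → Set
    Adjacent′ u v = ∃ λ e → (end₁′ e ≡ u × end₂′ e ≡ v) ⊎ (end₁′ e ≡ v × end₂′ e ≡ u)

    flip : ∀ {u v} → Star Adjacent′ u v → Star Adjacent′ v u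
    flip = reverse λ { (e , p) → e , swap p }

    reach : ∀ e i → Star Adjacent′ (inj₁ (end₁ e)) (end₁′ (e , i))
    reach e = <-weakInduction (λ i → Star Adjacent′ (inj₁ (end₁ e)) (end₁′ (e , i))) ε
      λ i p → p ◅◅ (((e , inject₁ i) , inj₁ (refl , cong (nextVertex e) (view-inject₁ i))) ◅ ε)

    across : ∀ e → Star Adjacent′ (inj₁ (end₁ e)) (inj₁ (end₂ e))
    across e = reach e (fromℕ (m e)) ◅◅
      (((e , fromℕ (m e)) , inj₁ (refl , cong (nextVertex e) (view-fromℕ (m e)))) ◅ ε)

    lift : ∀ {u v} → Star Adjacent u v → Star Adjacent′ (inj₁ u) (inj₁ v)
    lift = kleisliStar inj₁ λ { (e , inj₁ (refl , refl)) → across e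
                              ; (e , inj₂ (refl , refl)) → flip (across e) }

    anchor : V′ → V
    anchor (inj₁ v)       = v
    anchor (inj₂ (e , _)) = end₁ e

    toAnchor : ∀ x → Star Adjacent′ (inj₁ (anchor x)) x
    toAnchor (inj₁ v)       = ε
    toAnchor (inj₂ (e , i)) = reach e (suc i)

  subdivide : Graph
  subdivide = record
    { V          = V′
    ; E          = E′
    ; finiteV    = finite-⊎ finiteV (finite-Σ finiteE (λ e → finite-Fin (m e)))
    ; finiteE    = finite-Σ finiteE (λ e → finite-Fin (suc (m e)))
    ; end₁       = end₁′
    ; end₂       = end₂′
    ; loopless   = loopless′
    ; noParallel = noParallel′
    ; connected  = λ u v → flip (toAnchor u) ◅◅ lift (connected (anchor u) (anchor v)) ◅◅ toAnchor v
    }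

open Subdivision public using (subdivide)

-- How many vertices are added to the top and to the bottom edge of a square.
record Added : Set where
  constructor added
  field
    onTop onBottom : ℕ

unchanged endHexagon : Added
unchanged  = added 0 0
endHexagon = added 0 2

innerHexagon : Fin 3 → Added
innerHexagon a = added (toℕ a) (2 ∸ toℕ a)

-- S₂, …, S₂ₙ₋₁ for n = 2 + k
squaresAfterFirst : ∀ {k} → Vec (Fin 3) k → Vec Added (2 ℕ+ k ℕ* 2)
squaresAfterFirst []      = unchanged ∷ endHexagon ∷ []
squaresAfterFirst (a ∷ w) = unchanged ∷ innerHexagon a ∷ squaresAfterFirst w

squares : ∀ {k} → Vec (Fin 3) k → Vec Added ((2 ℕ+ k) ℕ* 2 ∸ 1)
squares w = endHexagon ∷ squaresAfterFirst w

addedTo : ∀ {L} → Vec Added L → LadderE L → ℕ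
addedTo as (topEdge j)    = Added.onTop (lookup as j)
addedTo as (bottomEdge j) = Added.onBottom (lookup as j)
addedTo as (rung j)       = 0

-- G(w) has n = 2 + k hexagons, where k is the length of w.
phenyleneChain : ∀ {k} → Vec (Fin 3) k → Graph
phenyleneChain {k} w = subdivide (ladder ((2 ℕ+ k) ℕ* 2 ∸ 1)) (addedTo (squares w))

-- Meaningful for n ≥ 2.
helicene : ℕ → Graph
helicene n = phenyleneChain (replicate (n ∸ 2) zero)

{-# OPTIONS --safe #-}

-- Peel the polygons of the chain off one at a time.  If t and s are the ends of
-- the first rung of the rest of the chain, the next polygon is an ear: a path
-- of length M from t to s.  It replaces the resistances ρ by
--   ρ u v − (p u − p v)² / 4D,   p u = ρ t u − ρ s u,   D = M + ρ t s,
-- and the same formula with a position in place of p holds on the ear.  The ear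
-- does not depend on the orientation of a hexagon; only the place d on it where
-- the next rung is attached does.  Hence the sums of 1, p, p², ρ t + ρ s over
-- the vertices and of ρ, (p u − p v)² over the pairs obey a recursion in which d enters only
-- through −2 d ∑p + d² m with m ≥ 0.  The recursion is monotone, and choosing
-- the same extreme orientation at every step makes this term largest and the
-- sum of ρ smallest.
module Submission where

open import Defs
open import Data.Fin.Base using (Fin; zero; suc; toℕ; fromℕ; inject₁)
open import Data.Fin.Relation.Unary.Top using (view; ‵fromℕ; ‵inject₁)
import Data.Integer.Base as ℤ
open import Data.List.Base using (List; []; _∷_; map; _++_; concatMap; allFin)
open import Data.List.Properties using (map-tabulate)
open import Data.Nat.Base using (ℕ; zero; suc; _∸_; ∣_-_∣) renaming (_≤_ to _ℕ≤_)
open import Data.Nat.Properties using (∣-∣-comm; ∣-∣-identityʳ; ∣n-n∣≡0)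
open import Data.Product.Base using (Σ; _×_; _,_)
open import Data.Rational.Base using (ℚ; 0ℚ; 1ℚ; ½; _+_; _*_; _-_; -_; _/_; _≤_; 1/_; Positive; NonNegative; positive; nonNegative)
open import Data.Rational.Properties
open import Data.Rational.Solver using (module +-*-Solver)
open import Data.Sum.Base using (_⊎_; inj₁; inj₂)
open import Data.Vec.Base using (Vec; []; _∷_; replicate)
open import Relation.Binary.PropositionalEquality using (_≡_; refl; sym; trans; cong; cong₂; subst; subst₂; module ≡-Reasoning)

open +-*-Solver

-- No electrical reduction is carried out. A closed formula for all resistances is proposed and
-- verified against a Laplace equation in weak form, which determines resistances; the choice of
-- potentials in `unitFlow` then never has to be inspected. The obstacle to an induction is that the
-- orientation of a polygon leaves the total unchanged when it is attached and acts only through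
-- later ears, so the moments of p must be compared along with the total. They do not all point the
-- same way: half the double sum of (p u - p v)² is n ∑p² - (∑p)², and the helicene makes both ∑p²
-- and (∑p)² large. Treated as a quantity of its own, it has a recursion in which (∑p)² does not
-- occur separately. The extreme orientation wins because ∑p becomes (∑p - d m) / D: when every d is
-- nonnegative, ∑p is pushed in one direction only, so -2 d ∑p and d² m never work against each
-- other. The lengths D depend on the sizes of the polygons alone, so two chains are compared with
-- identical coefficients at each step.

private variable
  I J : Set

-- Finite sums and linear combinations of summands.

∑-cong : (xs : List I) {f g : I → ℚ} → (∀ x → f x ≡ g x) → ∑ xs f ≡ ∑ xs g
∑-cong []       eq = refl
∑-cong (x ∷ xs) eq = cong₂ _+_ (eq x) (∑-cong xs eq)

∑-++ : (xs ys : List I) (f : I → ℚ) → ∑ (xs ++ ys) f ≡ ∑ xs f + ∑ ys f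
∑-++ []       ys f = sym (+-identityˡ _)
∑-++ (x ∷ xs) ys f = trans (cong (f x +_) (∑-++ xs ys f)) (sym (+-assoc (f x) _ _))

∑-map : (h : I → J) (xs : List I) (f : J → ℚ) → ∑ (map h xs) f ≡ ∑ xs (λ x → f (h x))
∑-map h []       f = refl
∑-map h (x ∷ xs) f = cong (f (h x) +_) (∑-map h xs f)

∑-concatMap : (h : I → List J) (xs : List I) (f : J → ℚ) →
              ∑ (concatMap h xs) f ≡ ∑ xs (λ x → ∑ (h x) f)
∑-concatMap h []       f = refl
∑-concatMap h (x ∷ xs) f = trans (∑-++ (h x) _ f) (cong (∑ (h x) f +_) (∑-concatMap h xs f))

∑-allFin : ∀ n (f : Fin (suc n) → ℚ) → ∑ (allFin (suc n)) f ≡ f zero + ∑ (allFin n) (λ i → f (suc i))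
∑-allFin n f = cong (f zero +_)
  (trans (cong (λ xs → ∑ xs f) (sym (map-tabulate {n = n} (λ i → i) suc))) (∑-map suc (allFin n) f))

-- A linear combination is kept as a list of coefficients and functions, so that one ring identity
-- brings a summand into this form and `∑-lin` or `energy-lin` then distributes the whole sum at
-- once.
lin : List (ℚ × (I → ℚ)) → I → ℚ
lin []             x = 0ℚ
lin ((k , g) ∷ cs) x = k * g x + lin cs x

linOf : ((I → ℚ) → ℚ) → List (ℚ × (I → ℚ)) → ℚ
linOf Φ []             = 0ℚ
linOf Φ ((k , g) ∷ cs) = k * Φ g + linOf Φ cs

∑-zero : (xs : List I) → ∑ xs (λ _ → 0ℚ) ≡ 0ℚ
∑-zero []       = refl
∑-zero (x ∷ xs) = trans (+-identityˡ _) (∑-zero xs)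

∑-axpy : (xs : List I) (k : ℚ) (f g : I → ℚ) →
         ∑ xs (λ x → k * f x + g x) ≡ k * ∑ xs f + ∑ xs g
∑-axpy []       k f g = solve 1 (λ k → con 0ℚ := k :* con 0ℚ :+ con 0ℚ) refl k
∑-axpy (x ∷ xs) k f g = trans (cong (k * f x + g x +_) (∑-axpy xs k f g))
  (solve 5 (λ k f g s t → (k :* f :+ g) :+ (k :* s :+ t) := k :* (f :+ s) :+ (g :+ t)) refl
    k (f x) (g x) (∑ xs f) (∑ xs g))

∑-lin : (xs : List I) (cs : List (ℚ × (I → ℚ))) → ∑ xs (lin cs) ≡ linOf (∑ xs) cs
∑-lin xs []             = ∑-zero xs
∑-lin xs ((k , g) ∷ cs) = trans (∑-axpy xs k g (lin cs)) (cong (k * ∑ xs g +_) (∑-lin xs cs))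

∑-+ : (xs : List I) (f g : I → ℚ) → ∑ xs (λ x → f x + g x) ≡ ∑ xs f + ∑ xs g
∑-+ []       f g = refl
∑-+ (x ∷ xs) f g = trans (cong (f x + g x +_) (∑-+ xs f g))
  (solve 4 (λ a b c d → (a :+ b) :+ (c :+ d) := (a :+ c) :+ (b :+ d)) refl
    (f x) (g x) (∑ xs f) (∑ xs g))

∑-swap : (xs : List I) (ys : List J) (f : I → J → ℚ) →
         ∑ xs (λ x → ∑ ys (f x)) ≡ ∑ ys (λ y → ∑ xs (λ x → f x y))
∑-swap []       ys f = sym (∑-zero ys)
∑-swap (x ∷ xs) ys f = trans (cong (∑ ys (f x) +_) (∑-swap xs ys f)) (sym (∑-+ ys (f x) _))

∑-pairs-cong : (xs : List I) {f g : I → I → ℚ} → (∀ x y → f x y ≡ g x y) →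
               ∑-pairs xs f ≡ ∑-pairs xs g
∑-pairs-cong []       eq = refl
∑-pairs-cong (x ∷ xs) eq = cong₂ _+_ (∑-cong xs (eq x)) (∑-pairs-cong xs eq)

-- The sum over pairs follows the order of the list, while the double sum can be split along any
-- decomposition of the vertex set. Twice the Kirchhoff index is therefore the quantity that is
-- tracked.
∑-pairs-double : (xs : List I) (f : I → I → ℚ) → (∀ x y → f x y ≡ f y x) → (∀ x → f x x ≡ 0ℚ) →
                 ∑-pairs xs f + ∑-pairs xs f ≡ ∑ xs (λ x → ∑ xs (f x))
∑-pairs-double []       f f-sym f-diag = refl
∑-pairs-double (x ∷ xs) f f-sym f-diag = sym (begin
  (f x x + ∑ xs (f x)) + ∑ xs (λ y → f y x + ∑ xs (f y))
    ≡⟨ cong₂ (λ a b → (a + ∑ xs (f x)) + b) (f-diag x) (∑-+ xs (λ y → f y x) (λ y → ∑ xs (f y))) ⟩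
  (0ℚ + ∑ xs (f x)) + (∑ xs (λ y → f y x) + ∑ xs (λ y → ∑ xs (f y)))
    ≡⟨ cong₂ (λ a b → (0ℚ + ∑ xs (f x)) + (a + b)) (∑-cong xs (λ y → f-sym y x))
         (sym (∑-pairs-double xs f f-sym f-diag)) ⟩
  (0ℚ + ∑ xs (f x)) + (∑ xs (f x) + (∑-pairs xs f + ∑-pairs xs f))
    ≡⟨ solve 2 (λ a b → (con 0ℚ :+ a) :+ (a :+ (b :+ b)) := (a :+ b) :+ (a :+ b)) refl
         (∑ xs (f x)) (∑-pairs xs f) ⟩
  (∑ xs (f x) + ∑-pairs xs f) + (∑ xs (f x) + ∑-pairs xs f) ∎)
  where open ≡-Reasoning

-- The Dirichlet form and a weak characterisation of resistance.

module Energy (G : Graph) where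
  open Graph G

  energy : (V → ℚ) → (V → ℚ) → ℚ
  energy f g = ∑ edges (λ e → current f e * current g e)

  energy-sym : ∀ f g → energy f g ≡ energy g f
  energy-sym f g = ∑-cong edges (λ e → *-comm (current f e) (current g e))

  energy-cong : ∀ f {g h} → (∀ x → g x ≡ h x) → energy f g ≡ energy f h
  energy-cong f eq = ∑-cong edges (λ e → cong (current f e *_) (cong₂ _-_ (eq (end₁ e)) (eq (end₂ e))))

  energy-lin : ∀ f c cs → energy f (λ x → c + lin cs x) ≡ linOf (energy f) cs
  energy-lin f c [] = trans
    (∑-cong edges (λ e → solve 2 (λ a c → a :* ((c :+ con 0ℚ) :- (c :+ con 0ℚ)) := con 0ℚ) refl (current f e) c))
    (∑-zero edges)
  energy-lin f c ((k , g) ∷ cs) = trans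
    (∑-cong edges (λ e → solve 7 (λ a c k g g′ l l′ →
        a :* ((c :+ (k :* g :+ l)) :- (c :+ (k :* g′ :+ l′)))
          := k :* (a :* (g :- g′)) :+ a :* ((c :+ l) :- (c :+ l′))) refl
      (current f e) c k (g (end₁ e)) (g (end₂ e)) (lin cs (end₁ e)) (lin cs (end₂ e))))
    (trans (∑-axpy edges k _ _) (cong (k * energy f g +_) (energy-lin f c cs)))

  -- Discrete Green identity: each edge contributes the difference of two deltas, which sums against
  -- `f` to the drop of `f` along the edge.
  ∑-outflow : ∀ es f φ → ∑ vertices (λ x → f x * outflow es φ x) ≡ ∑ es (λ e → current f e * current φ e)
  ∑-outflow []       f φ = trans
    (∑-cong vertices (λ x → solve 1 (λ a → a :* con 0ℚ := con 0ℚ) refl (f x))) (∑-zero vertices)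
  ∑-outflow (e ∷ es) f φ = trans
    (Existence.∑-linear G vertices (current φ e) f _ (outflow es φ))
    (cong₂ _+_
      (trans (cong (current φ e *_) (Existence.∑-δ-δ G f (end₁ e) (end₂ e))) (*-comm (current φ e) (current f e)))
      (∑-outflow es f φ))

  unitFlow-energy : ∀ {u v} (F : UnitFlow u v) f → energy f (UnitFlow.potential F) ≡ f u - f v
  unitFlow-energy {u} {v} F f = trans (sym (∑-outflow edges f (UnitFlow.potential F)))
    (trans (∑-cong vertices (λ x → cong (f x *_) (UnitFlow.currentLaw F x))) (Existence.∑-δ-δ G f u v))

  -- The law says that the Laplacian of ρ u is 2 (κ − δ u) in weak form, for
  -- some measure κ which does not depend on u.
  record IsResistance (ρ : V → V → ℚ) : Set where
    field
      ρ-sym  : ∀ u v → ρ u v ≡ ρ v u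
      ρ-diag : ∀ u → ρ u u ≡ 0ℚ
      ρ-law  : ∀ f u v → energy f (ρ u) + (f u + f u) ≡ energy f (ρ v) + (f v + f v)

  module _ {ρ : V → V → ℚ} (isR : IsResistance ρ) where
    open IsResistance isR

    -- The law tested with the potential φ expresses 2 (φ u - φ v) as
    -- `energy φ (ρ v) - energy φ (ρ u)`. Since the form is symmetric, the current law of φ tested
    -- with `ρ w` evaluates these energies as `ρ w u - ρ w v`.
    resistance-unique : ∀ u v → resistance G u v ≡ ρ u v
    resistance-unique u v = begin
      φ u - φ v
        ≡⟨ solve 4 (λ a b x y → a :- b := con ½ :* ((x :+ (a :+ a)) :- x) :- con ½ :* ((y :+ (b :+ b)) :- y)) refl
             (φ u) (φ v) (energy φ (ρ u)) (energy φ (ρ v)) ⟩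
      ½ * ((energy φ (ρ u) + (φ u + φ u)) - energy φ (ρ u)) - ½ * ((energy φ (ρ v) + (φ v + φ v)) - energy φ (ρ v))
        ≡⟨ cong (λ z → ½ * (z - energy φ (ρ u)) - ½ * ((energy φ (ρ v) + (φ v + φ v)) - energy φ (ρ v))) (ρ-law φ u v) ⟩
      ½ * ((energy φ (ρ v) + (φ v + φ v)) - energy φ (ρ u)) - ½ * ((energy φ (ρ v) + (φ v + φ v)) - energy φ (ρ v))
        ≡⟨ solve 3 (λ x y b → con ½ :* ((y :+ b) :- x) :- con ½ :* ((y :+ b) :- y) := con ½ :* (y :- x)) refl
             (energy φ (ρ u)) (energy φ (ρ v)) (φ v + φ v) ⟩
      ½ * (energy φ (ρ v) - energy φ (ρ u))
        ≡⟨ cong₂ (λ y x → ½ * (y - x)) (at v) (at u) ⟩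
      ½ * ((ρ v u - ρ v v) - (ρ u u - ρ u v))
        ≡⟨ cong₂ (λ y x → ½ * ((ρ v u - y) - (x - ρ u v))) (ρ-diag v) (ρ-diag u) ⟩
      ½ * ((ρ v u - 0ℚ) - (0ℚ - ρ u v))
        ≡⟨ cong (λ y → ½ * ((y - 0ℚ) - (0ℚ - ρ u v))) (ρ-sym v u) ⟩
      ½ * ((ρ u v - 0ℚ) - (0ℚ - ρ u v))
        ≡⟨ solve 1 (λ x → con ½ :* ((x :- con 0ℚ) :- (con 0ℚ :- x)) := x) refl (ρ u v) ⟩
      ρ u v ∎
      where
      open ≡-Reasoning
      F : UnitFlow u v
      F = unitFlow G u v
      φ : V → ℚ
      φ = UnitFlow.potential F
      at : ∀ w → energy φ (ρ w) ≡ ρ w u - ρ w v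
      at w = trans (energy-sym φ (ρ w)) (unitFlow-energy F (ρ w))

    Kf-double : Kf G + Kf G ≡ ∑ vertices (λ u → ∑ vertices (ρ u))
    Kf-double = trans
      (cong (λ k → k + k) (∑-pairs-cong vertices resistance-unique))
      (∑-pairs-double vertices ρ ρ-sym ρ-diag)

-- Sums over unions and along the path that replaces an edge.

∑-⊎ : {A B : Set} (FA : Finite A) (FB : Finite B) (f : A ⊎ B → ℚ) →
      ∑ (Finite.elements (finite-⊎ FA FB)) f
      ≡ ∑ (Finite.elements FA) (λ x → f (inj₁ x)) + ∑ (Finite.elements FB) (λ y → f (inj₂ y))
∑-⊎ FA FB f = trans (∑-++ (map inj₁ (Finite.elements FA)) _ f)
  (cong₂ _+_ (∑-map inj₁ (Finite.elements FA) f) (∑-map inj₂ (Finite.elements FB) f))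

∑-Σ : {A : Set} {B : A → Set} (FA : Finite A) (FB : ∀ x → Finite (B x)) (f : Σ A B → ℚ) →
      ∑ (Finite.elements (finite-Σ FA FB)) f
      ≡ ∑ (Finite.elements FA) (λ x → ∑ (Finite.elements (FB x)) (λ y → f (x , y)))
∑-Σ FA FB f = trans (∑-concatMap _ (Finite.elements FA) f)
  (∑-cong (Finite.elements FA) (λ x → ∑-map (x ,_) (Finite.elements (FB x)) f))

-- The sequence F 1, …, F m, y.
next : ∀ {m} → (Fin (suc m) → ℚ) → ℚ → Fin (suc m) → ℚ
next {zero}  F y zero    = y
next {suc m} F y zero    = F (suc zero)
next {suc m} F y (suc k) = next (λ j → F (suc j)) y k

next-fromℕ : ∀ m (F : Fin (suc m) → ℚ) y → next F y (fromℕ m) ≡ y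
next-fromℕ zero    F y = refl
next-fromℕ (suc m) F y = next-fromℕ m (λ j → F (suc j)) y

next-inject₁ : ∀ {m} (F : Fin (suc m) → ℚ) y (j : Fin m) → next F y (inject₁ j) ≡ F (suc j)
next-inject₁ F y zero    = refl
next-inject₁ F y (suc j) = next-inject₁ (λ j → F (suc j)) y j

next-toℕ : ∀ {m} (F : Fin (suc m) → ℚ) y (H : ℕ → ℚ) → (∀ k → F k ≡ H (toℕ k)) → y ≡ H (suc m) →
           ∀ k → next F y k ≡ H (suc (toℕ k))
next-toℕ {zero}  F y H FH yH zero    = yH
next-toℕ {suc m} F y H FH yH zero    = FH (suc zero)
next-toℕ {suc m} F y H FH yH (suc k) = next-toℕ (λ j → F (suc j)) y (λ n → H (suc n)) (λ j → FH (suc j)) yH k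

-- The second function of an energy enters only through its differences. Having them as a free
-- argument `slope` allows a closed formula for the slope to be decomposed and summed term by term.
pathSum : ∀ {m} → (Fin (suc m) → ℚ) → ℚ → (Fin (suc m) → ℚ) → ℚ
pathSum {m} F y slope = ∑ (allFin (suc m)) (λ k → (F k - next F y k) * slope k)

pathEnergy : ∀ {m} → (Fin (suc m) → ℚ) → ℚ → (Fin (suc m) → ℚ) → ℚ → ℚ
pathEnergy F y G z = pathSum F y (λ k → G k - next G z k)

pathSum-cong : ∀ {m} (F : Fin (suc m) → ℚ) y {s t : Fin (suc m) → ℚ} → (∀ k → s k ≡ t k) →
               pathSum F y s ≡ pathSum F y t
pathSum-cong {m} F y eq = ∑-cong (allFin (suc m)) (λ k → cong ((F k - next F y k) *_) (eq k))

pathSum-suc : ∀ {m} (F : Fin (suc (suc m)) → ℚ) y (s : Fin (suc (suc m)) → ℚ) →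
  pathSum F y s ≡ (F zero - F (suc zero)) * s zero + pathSum (λ k → F (suc k)) y (λ k → s (suc k))
pathSum-suc {m} F y s = ∑-allFin (suc m) (λ k → (F k - next F y k) * s k)

pathSum-+ : ∀ {m} (F : Fin (suc m) → ℚ) y (s t : Fin (suc m) → ℚ) →
            pathSum F y (λ k → s k + t k) ≡ pathSum F y s + pathSum F y t
pathSum-+ {m} F y s t = trans
  (∑-cong (allFin (suc m)) (λ k → solve 3 (λ a s t → a :* (s :+ t) := a :* s :+ a :* t) refl
    (F k - next F y k) (s k) (t k)))
  (∑-+ (allFin (suc m)) (λ k → (F k - next F y k) * s k) (λ k → (F k - next F y k) * t k))

pathSum-const : ∀ {m} (F : Fin (suc m) → ℚ) y c → pathSum F y (λ _ → c) ≡ c * (F zero - y)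
pathSum-const {zero}  F y c = solve 2 (λ a c → a :* c :+ con 0ℚ := c :* a) refl (F zero - y) c
pathSum-const {suc m} F y c = trans (pathSum-suc F y (λ _ → c))
  (trans (cong ((F zero - F (suc zero)) * c +_) (pathSum-const (λ k → F (suc k)) y c))
    (solve 4 (λ a b y c → (a :- b) :* c :+ c :* (b :- y) := c :* (a :- y)) refl
      (F zero) (F (suc zero)) y c))

-- The slope of n ↦ ∣ j - n ∣ on the step from n to n + 1, with sign reversed.
kink : ℕ → ℕ → ℚ
kink zero    n       = - 1ℚ
kink (suc j) zero    = 1ℚ
kink (suc j) (suc n) = kink j n

-- The slope is 1 before `j` and -1 from `j` on, so the sum telescopes separately on the two sides
-- of `j`.
pathSum-kink : ∀ {m} (F : Fin (suc m) → ℚ) y (j : Fin (suc m)) →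
               pathSum F y (λ k → kink (toℕ j) (toℕ k)) ≡ (F zero - F j) - (F j - y)
pathSum-kink F y zero = trans (pathSum-const F y (- 1ℚ))
  (solve 2 (λ a y → :- con 1ℚ :* (a :- y) := (a :- a) :- (a :- y)) refl (F zero) y)
pathSum-kink {suc m} F y (suc j) = trans (pathSum-suc F y (λ k → kink (suc (toℕ j)) (toℕ k)))
  (trans (cong ((F zero - F (suc zero)) * 1ℚ +_) (pathSum-kink (λ k → F (suc k)) y j))
    (solve 4 (λ a b c y → (a :- b) :* con 1ℚ :+ ((b :- c) :- (c :- y)) := (a :- c) :- (c :- y)) refl
      (F zero) (F (suc zero)) (F (suc j)) y))

module _ (G : Graph) (m : Graph.E G → ℕ) where
  open Graph G
  open Subdivision G m using (V′; end₁′; end₂′)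

  -- `end₂′` goes through `view`, which is stuck on a general index; `next` recurses on the length
  -- of the path, so that sums along the edge are open to induction.
  ∑-pathEdges : ∀ e (f g : V′ → ℚ) →
    ∑ (allFin (suc (m e))) (λ k → (f (end₁′ (e , k)) - f (end₂′ (e , k))) * (g (end₁′ (e , k)) - g (end₂′ (e , k))))
    ≡ pathEnergy (λ k → f (end₁′ (e , k))) (f (inj₁ (end₂ e))) (λ k → g (end₁′ (e , k))) (g (inj₁ (end₂ e)))
  ∑-pathEdges e f g = ∑-cong (allFin (suc (m e))) (λ k →
    cong₂ (λ a b → (f (end₁′ (e , k)) - a) * (g (end₁′ (e , k)) - b)) (end f k) (end g k))
    where
    end : ∀ (h : V′ → ℚ) k → h (end₂′ (e , k)) ≡ next (λ k → h (end₁′ (e , k))) (h (inj₁ (end₂ e))) k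
    end h k with view k
    ... | ‵fromℕ     = sym (next-fromℕ (m e) (λ k → h (end₁′ (e , k))) (h (inj₁ (end₂ e))))
    ... | ‵inject₁ j = sym (next-inject₁ (λ k → h (end₁′ (e , k))) (h (inj₁ (end₂ e))) j)

-- Splitting a chain into its first ear and the remaining chain.

chain : ∀ {L} → Vec Added L → Graph
chain {L} as = subdivide (ladder L) (addedTo as)

ChainV : ∀ {L} → Vec Added L → Set
ChainV as = Graph.V (chain as)

-- The vertices of the chain which the first polygon does not share with the
-- second one.  On both arms, index 0 is the end of the first rung.
Ear : Added → Set
Ear x = Fin (suc (Added.onTop x)) ⊎ Fin (suc (Added.onBottom x))

finite-Ear : ∀ x → Finite (Ear x)
finite-Ear x = finite-⊎ (finite-Fin _) (finite-Fin _)

ears : ∀ x → List (Ear x)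
ears x = Finite.elements (finite-Ear x)

module _ {L} (x : Added) (as : Vec Added L) where

  old : ChainV as → ChainV (x ∷ as)
  old (inj₁ (top j))              = inj₁ (top (suc j))
  old (inj₁ (bottom j))           = inj₁ (bottom (suc j))
  old (inj₂ (topEdge j , i))      = inj₂ (topEdge (suc j) , i)
  old (inj₂ (bottomEdge j , i))   = inj₂ (bottomEdge (suc j) , i)

  ear : Ear x → ChainV (x ∷ as)
  ear (top zero)       = inj₁ (top zero)
  ear (top (suc i))    = inj₂ (topEdge zero , i)
  ear (bottom zero)    = inj₁ (bottom zero)
  ear (bottom (suc i)) = inj₂ (bottomEdge zero , i)

  split : ChainV (x ∷ as) → Ear x ⊎ ChainV as
  split (inj₁ (top zero))                  = inj₁ (top zero)
  split (inj₁ (top (suc j)))               = inj₂ (inj₁ (top j))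
  split (inj₁ (bottom zero))               = inj₁ (bottom zero)
  split (inj₁ (bottom (suc j)))            = inj₂ (inj₁ (bottom j))
  split (inj₂ (topEdge zero , i))          = inj₁ (top (suc i))
  split (inj₂ (topEdge (suc j) , i))       = inj₂ (inj₂ (topEdge j , i))
  split (inj₂ (bottomEdge zero , i))       = inj₁ (bottom (suc i))
  split (inj₂ (bottomEdge (suc j) , i))    = inj₂ (inj₂ (bottomEdge j , i))

  join : Ear x ⊎ ChainV as → ChainV (x ∷ as)
  join (inj₁ e) = ear e
  join (inj₂ v) = old v

  split-join : ∀ z → split (join z) ≡ z
  split-join (inj₁ (top zero))                  = refl
  split-join (inj₁ (top (suc i)))               = refl
  split-join (inj₁ (bottom zero))               = refl
  split-join (inj₁ (bottom (suc i)))            = refl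
  split-join (inj₂ (inj₁ (top j)))              = refl
  split-join (inj₂ (inj₁ (bottom j)))           = refl
  split-join (inj₂ (inj₂ (topEdge j , i)))      = refl
  split-join (inj₂ (inj₂ (bottomEdge j , i)))   = refl

  join-split : ∀ v → join (split v) ≡ v
  join-split (inj₁ (top zero))                  = refl
  join-split (inj₁ (top (suc j)))               = refl
  join-split (inj₁ (bottom zero))               = refl
  join-split (inj₁ (bottom (suc j)))            = refl
  join-split (inj₂ (topEdge zero , i))          = refl
  join-split (inj₂ (topEdge (suc j) , i))       = refl
  join-split (inj₂ (bottomEdge zero , i))       = refl
  join-split (inj₂ (bottomEdge (suc j) , i))    = refl

module _ {L} (as : Vec Added L) (f : ChainV as → ℚ) where

  tops bottoms : Fin (suc L) → ℚ
  tops    j = f (inj₁ (top j))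
  bottoms j = f (inj₁ (bottom j))

  inner : LadderE L → ℚ
  inner e = ∑ (allFin (addedTo as e)) (λ i → f (inj₂ (e , i)))

  -- The enumeration of the vertices interleaves the ear with the rest. Sorted by kind, each family
  -- is indexed by a `Fin` whose term at `zero` belongs to the ear and whose other terms are the
  -- same family of the shorter chain.
  ∑-chainV : ∑ (Graph.vertices (chain as)) f
    ≡ (∑ (allFin (suc L)) tops + ∑ (allFin (suc L)) bottoms)
      + (∑ (allFin L) (λ j → inner (topEdge j)) + ∑ (allFin L) (λ j → inner (bottomEdge j)))
  ∑-chainV = begin
    ∑ (Graph.vertices (chain as)) f
      ≡⟨ ∑-⊎ (Graph.finiteV (ladder L)) (finite-Σ (Graph.finiteE (ladder L)) inners) f ⟩
    ∑ (Graph.vertices (ladder L)) (λ v → f (inj₁ v))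
      + ∑ (Finite.elements (finite-Σ (Graph.finiteE (ladder L)) inners)) (λ z → f (inj₂ z))
      ≡⟨ cong₂ _+_ (∑-⊎ (finite-Fin (suc L)) (finite-Fin (suc L)) (λ v → f (inj₁ v)))
           (∑-Σ (Graph.finiteE (ladder L)) inners (λ z → f (inj₂ z))) ⟩
    both + ∑ (Graph.edges (ladder L)) inner
      ≡⟨ cong (both +_) (∑-⊎ (finite-Fin L) (finite-⊎ (finite-Fin L) (finite-Fin (suc L))) inner) ⟩
    both + (∑ (allFin L) (λ j → inner (topEdge j))
      + ∑ (Finite.elements (finite-⊎ (finite-Fin L) (finite-Fin (suc L)))) (λ e → inner (inj₂ e)))
      ≡⟨ cong (λ z → both + (∑ (allFin L) (λ j → inner (topEdge j)) + z))
           (trans (∑-⊎ (finite-Fin L) (finite-Fin (suc L)) (λ e → inner (inj₂ e)))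
           (trans (cong (∑ (allFin L) (λ j → inner (bottomEdge j)) +_) (∑-zero (allFin (suc L))))
             (+-identityʳ (∑ (allFin L) (λ j → inner (bottomEdge j)))))) ⟩
    both + (∑ (allFin L) (λ j → inner (topEdge j)) + ∑ (allFin L) (λ j → inner (bottomEdge j))) ∎
    where
    open ≡-Reasoning
    both : ℚ
    both = ∑ (allFin (suc L)) tops + ∑ (allFin (suc L)) bottoms
    inners : ∀ e → Finite (Fin (addedTo as e))
    inners e = finite-Fin (addedTo as e)

module _ {L} (x : Added) (as : Vec Added L) (f : ChainV (x ∷ as) → ℚ) where
  private
    f′ : ChainV as → ℚ
    f′ v = f (old x as v)

    ∑ears : ∑ (ears x) (λ e → f (ear x as e))
      ≡ (tops (x ∷ as) f zero + inner (x ∷ as) f (topEdge zero))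
        + (bottoms (x ∷ as) f zero + inner (x ∷ as) f (bottomEdge zero))
    ∑ears = trans (∑-⊎ (finite-Fin _) (finite-Fin _) (λ e → f (ear x as e)))
      (cong₂ _+_ (∑-allFin (Added.onTop x) (λ k → f (ear x as (top k))))
                 (∑-allFin (Added.onBottom x) (λ k → f (ear x as (bottom k)))))

  ∑-split : ∑ (Graph.vertices (chain (x ∷ as))) f
    ≡ ∑ (ears x) (λ e → f (ear x as e)) + ∑ (Graph.vertices (chain as)) f′
  ∑-split = begin
    ∑ (Graph.vertices (chain (x ∷ as))) f
      ≡⟨ ∑-chainV (x ∷ as) f ⟩
    (∑ (allFin (suc (suc L))) (tops (x ∷ as) f) + ∑ (allFin (suc (suc L))) (bottoms (x ∷ as) f))
      + (∑ (allFin (suc L)) (λ j → inner (x ∷ as) f (topEdge j))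
         + ∑ (allFin (suc L)) (λ j → inner (x ∷ as) f (bottomEdge j)))
      ≡⟨ cong₂ _+_
           (cong₂ _+_ (∑-allFin (suc L) (tops (x ∷ as) f)) (∑-allFin (suc L) (bottoms (x ∷ as) f)))
           (cong₂ _+_ (∑-allFin L (λ j → inner (x ∷ as) f (topEdge j)))
                      (∑-allFin L (λ j → inner (x ∷ as) f (bottomEdge j)))) ⟩
    ((t + T) + (b + B)) + ((t′ + T′) + (b′ + B′))
      ≡⟨ solve 8 (λ t T b B t′ T′ b′ B′ → ((t :+ T) :+ (b :+ B)) :+ ((t′ :+ T′) :+ (b′ :+ B′))
           := ((t :+ t′) :+ (b :+ b′)) :+ ((T :+ B) :+ (T′ :+ B′))) refl t T b B t′ T′ b′ B′ ⟩
    ((t + t′) + (b + b′)) + ((T + B) + (T′ + B′))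
      ≡⟨ sym (cong₂ _+_ ∑ears (∑-chainV as f′)) ⟩
    ∑ (ears x) (λ e → f (ear x as e)) + ∑ (Graph.vertices (chain as)) f′ ∎
    where
    open ≡-Reasoning
    t T b B t′ T′ b′ B′ : ℚ
    t  = tops (x ∷ as) f zero
    T  = ∑ (allFin (suc L)) (tops as f′)
    b  = bottoms (x ∷ as) f zero
    B  = ∑ (allFin (suc L)) (bottoms as f′)
    t′ = inner (x ∷ as) f (topEdge zero)
    T′ = ∑ (allFin L) (λ j → inner as f′ (topEdge j))
    b′ = inner (x ∷ as) f (bottomEdge zero)
    B′ = ∑ (allFin L) (λ j → inner as f′ (bottomEdge j))

module _ {L} (as : Vec Added L) where
  open Subdivision (ladder L) (addedTo as) using (end₁′; end₂′)

  alongEdge : (ChainV as → ℚ) → (e : LadderE L) → Fin (suc (addedTo as e)) → ℚ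
  alongEdge f e k = f (end₁′ (e , k))

  edgeEnergy : (f g : ChainV as → ℚ) → LadderE L → ℚ
  edgeEnergy f g e = pathEnergy (alongEdge f e) (f (inj₁ (ladderEnd₂ e)))
                                (alongEdge g e) (g (inj₁ (ladderEnd₂ e)))

  energy-chain : ∀ f g → Energy.energy (chain as) f g
    ≡ ∑ (allFin L) (λ j → edgeEnergy f g (topEdge j))
      + (∑ (allFin L) (λ j → edgeEnergy f g (bottomEdge j))
         + ∑ (allFin (suc L)) (λ j → edgeEnergy f g (rung j)))
  energy-chain f g = trans
    (∑-Σ (Graph.finiteE (ladder L)) (λ e → finite-Fin (suc (addedTo as e)))
      (λ e → (f (end₁′ e) - f (end₂′ e)) * (g (end₁′ e) - g (end₂′ e))))
    (trans (∑-cong (Graph.edges (ladder L)) (λ e → ∑-pathEdges (ladder L) (addedTo as) e f g))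
    (trans (∑-⊎ (finite-Fin L) (finite-⊎ (finite-Fin L) (finite-Fin (suc L))) (edgeEnergy f g))
      (cong (∑ (allFin L) (λ j → edgeEnergy f g (topEdge j)) +_)
        (∑-⊎ (finite-Fin L) (finite-Fin (suc L)) (λ e → edgeEnergy f g (inj₂ e))))))

pathEnergy-cong : ∀ {m} (F F′ G G′ : Fin (suc m) → ℚ) y z → (∀ k → F k ≡ F′ k) → (∀ k → G k ≡ G′ k) →
                  pathEnergy F y G z ≡ pathEnergy F′ y G′ z
pathEnergy-cong {m} F F′ G G′ y z FF GG = ∑-cong (allFin (suc m)) (λ k → cong₂ _*_
  (cong₂ _-_ (FF k) (next-cong F F′ y FF k)) (cong₂ _-_ (GG k) (next-cong G G′ z GG k)))
  where
  next-cong : ∀ {m} (F F′ : Fin (suc m) → ℚ) y → (∀ k → F k ≡ F′ k) → ∀ k → next F y k ≡ next F′ y k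
  next-cong {zero}  F F′ y FF zero    = refl
  next-cong {suc m} F F′ y FF zero    = FF (suc zero)
  next-cong {suc m} F F′ y FF (suc k) = next-cong (λ j → F (suc j)) (λ j → F′ (suc j)) y (λ j → FF (suc j)) k

module _ {L} (x : Added) (as : Vec Added L) (f : ChainV (x ∷ as) → ℚ) where
  private
    f′ : ChainV as → ℚ
    f′ v = f (old x as v)

  armᵗ : Fin (suc (Added.onTop x)) → ℚ
  armᵗ k = f (ear x as (top k))

  armᵇ : Fin (suc (Added.onBottom x)) → ℚ
  armᵇ k = f (ear x as (bottom k))

  along-topEdge : ∀ k → alongEdge (x ∷ as) f (topEdge zero) k ≡ armᵗ k
  along-topEdge zero    = refl
  along-topEdge (suc k) = refl

  along-bottomEdge : ∀ k → alongEdge (x ∷ as) f (bottomEdge zero) k ≡ armᵇ k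
  along-bottomEdge zero    = refl
  along-bottomEdge (suc k) = refl

  along-topEdge-old : ∀ j k → alongEdge (x ∷ as) f (topEdge (suc j)) k ≡ alongEdge as f′ (topEdge j) k
  along-topEdge-old j zero    = refl
  along-topEdge-old j (suc k) = refl

  along-bottomEdge-old : ∀ j k → alongEdge (x ∷ as) f (bottomEdge (suc j)) k ≡ alongEdge as f′ (bottomEdge j) k
  along-bottomEdge-old j zero    = refl
  along-bottomEdge-old j (suc k) = refl

  along-rung-old : ∀ j k → alongEdge (x ∷ as) f (rung (suc j)) k ≡ alongEdge as f′ (rung j) k
  along-rung-old j zero = refl

module _ {L} (x : Added) (as : Vec Added L) (f g : ChainV (x ∷ as) → ℚ) where
  private
    f′ g′ : ChainV as → ℚ
    f′ v = f (old x as v)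
    g′ v = g (old x as v)

  earEnergy : ℚ
  earEnergy =
    (pathEnergy (armᵗ x as f) (f′ (inj₁ (top zero))) (armᵗ x as g) (g′ (inj₁ (top zero)))
     + pathEnergy (armᵇ x as f) (f′ (inj₁ (bottom zero))) (armᵇ x as g) (g′ (inj₁ (bottom zero))))
    + (armᵗ x as f zero - armᵇ x as f zero) * (armᵗ x as g zero - armᵇ x as g zero)

  energy-split : Energy.energy (chain (x ∷ as)) f g ≡ Energy.energy (chain as) f′ g′ + earEnergy
  energy-split = begin
    Energy.energy (chain (x ∷ as)) f g
      ≡⟨ energy-chain (x ∷ as) f g ⟩
    ∑ (allFin (suc L)) (λ j → edge⁺ (topEdge j))
      + (∑ (allFin (suc L)) (λ j → edge⁺ (bottomEdge j)) + ∑ (allFin (suc (suc L))) (λ j → edge⁺ (rung j)))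
      ≡⟨ cong₂ _+_ (∑-allFin L (λ j → edge⁺ (topEdge j)))
           (cong₂ _+_ (∑-allFin L (λ j → edge⁺ (bottomEdge j))) (∑-allFin (suc L) (λ j → edge⁺ (rung j)))) ⟩
    (edge⁺ (topEdge zero) + ∑ (allFin L) (λ j → edge⁺ (topEdge (suc j))))
      + ((edge⁺ (bottomEdge zero) + ∑ (allFin L) (λ j → edge⁺ (bottomEdge (suc j))))
         + (edge⁺ (rung zero) + ∑ (allFin (suc L)) (λ j → edge⁺ (rung (suc j)))))
      ≡⟨ cong₂ _+_
           (cong₂ _+_
             (pathEnergy-cong (alongEdge (x ∷ as) f (topEdge zero)) (armᵗ x as f)
                              (alongEdge (x ∷ as) g (topEdge zero)) (armᵗ x as g)
                              (f′ (inj₁ (top zero))) (g′ (inj₁ (top zero)))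
                              (along-topEdge x as f) (along-topEdge x as g))
             (∑-cong (allFin L) (λ j →
               pathEnergy-cong (alongEdge (x ∷ as) f (topEdge (suc j))) (alongEdge as f′ (topEdge j))
                               (alongEdge (x ∷ as) g (topEdge (suc j))) (alongEdge as g′ (topEdge j))
                               (f′ (inj₁ (top (suc j)))) (g′ (inj₁ (top (suc j))))
                               (along-topEdge-old x as f j) (along-topEdge-old x as g j))))
           (cong₂ _+_
             (cong₂ _+_
               (pathEnergy-cong (alongEdge (x ∷ as) f (bottomEdge zero)) (armᵇ x as f)
                                (alongEdge (x ∷ as) g (bottomEdge zero)) (armᵇ x as g)
                                (f′ (inj₁ (bottom zero))) (g′ (inj₁ (bottom zero)))
                                (along-bottomEdge x as f) (along-bottomEdge x as g))
               (∑-cong (allFin L) (λ j →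
                 pathEnergy-cong (alongEdge (x ∷ as) f (bottomEdge (suc j))) (alongEdge as f′ (bottomEdge j))
                                 (alongEdge (x ∷ as) g (bottomEdge (suc j))) (alongEdge as g′ (bottomEdge j))
                                 (f′ (inj₁ (bottom (suc j)))) (g′ (inj₁ (bottom (suc j))))
                                 (along-bottomEdge-old x as f j) (along-bottomEdge-old x as g j))))
             (cong₂ _+_
               -- The rung is not subdivided: its path energy is a single product followed by the
               -- empty sum.
               (+-identityʳ c)
               (∑-cong (allFin (suc L)) (λ j →
                 pathEnergy-cong (alongEdge (x ∷ as) f (rung (suc j))) (alongEdge as f′ (rung j))
                                 (alongEdge (x ∷ as) g (rung (suc j))) (alongEdge as g′ (rung j))
                                 (f′ (inj₁ (bottom j))) (g′ (inj₁ (bottom j)))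
                                 (along-rung-old x as f j) (along-rung-old x as g j))))) ⟩
    (a + A) + ((b + B) + (c + C))
      ≡⟨ solve 6 (λ a A b B c C → (a :+ A) :+ ((b :+ B) :+ (c :+ C)) := (A :+ (B :+ C)) :+ ((a :+ b) :+ c))
           refl a A b B c C ⟩
    (A + (B + C)) + ((a + b) + c)
      ≡⟨ cong (_+ ((a + b) + c)) (sym (energy-chain as f′ g′)) ⟩
    Energy.energy (chain as) f′ g′ + earEnergy ∎
    where
    open ≡-Reasoning
    edge⁺ : LadderE (suc L) → ℚ
    edge⁺ = edgeEnergy (x ∷ as) f g
    a A b B c C : ℚ
    a = pathEnergy (armᵗ x as f) (f′ (inj₁ (top zero))) (armᵗ x as g) (g′ (inj₁ (top zero)))
    A = ∑ (allFin L) (λ j → edgeEnergy as f′ g′ (topEdge j))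
    b = pathEnergy (armᵇ x as f) (f′ (inj₁ (bottom zero))) (armᵇ x as g) (g′ (inj₁ (bottom zero)))
    B = ∑ (allFin L) (λ j → edgeEnergy as f′ g′ (bottomEdge j))
    c = (armᵗ x as f zero - armᵇ x as f zero) * (armᵗ x as g zero - armᵇ x as g zero)
    C = ∑ (allFin (suc L)) (λ j → edgeEnergy as f′ g′ (rung j))

-- The resistance formula after attaching an ear.

2ℚ 3ℚ ¼ : ℚ
2ℚ = ℤ.+ 2 / 1
3ℚ = ℤ.+ 3 / 1
¼  = ℤ.+ 1 / 4

-- The recursion makes `ι (suc n)` unfold to `1ℚ + ι n`, a form that the ring solver can use.
ι : ℕ → ℚ
ι zero    = 0ℚ
ι (suc n) = 1ℚ + ι n

ι-gap-kink : ∀ j n → ι ∣ j - n ∣ - ι ∣ j - suc n ∣ ≡ kink j n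
ι-gap-kink zero    n       = solve 1 (λ n → n :- (con 1ℚ :+ n) := :- con 1ℚ) refl (ι n)
ι-gap-kink (suc j) zero    rewrite ∣-∣-identityʳ j = solve 1 (λ j → (con 1ℚ :+ j) :- j := con 1ℚ) refl (ι j)
ι-gap-kink (suc j) (suc n) = ι-gap-kink j n

ι-gap-end : ∀ {m} (j : Fin (suc m)) → ι ∣ toℕ j - suc m ∣ ≡ (1ℚ + ι m) - ι (toℕ j)
ι-gap-end {m}     zero    = solve 1 (λ m → con 1ℚ :+ m := (con 1ℚ :+ m) :- con 0ℚ) refl (ι m)
ι-gap-end {suc m} (suc j) = trans (ι-gap-end j)
  (solve 2 (λ m j → (con 1ℚ :+ m) :- j := (con 1ℚ :+ (con 1ℚ :+ m)) :- (con 1ℚ :+ j)) refl (ι m) (ι (toℕ j)))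

-- The slope of `ρ⁺ z` along an arm has three parts: `b` from `base`, `w` from the square of the
-- coordinate along the arm, and the constant `c` from its product with the coordinate of `z`. Only
-- `w` is the same for all `z`, and it ends up in the constant of the law.
path-quadratic : ∀ {m} (F : Fin (suc m) → ℚ) y (G : Fin (suc m) → ℚ) e (H b w : ℕ → ℚ) c →
  (∀ k → G k ≡ H (toℕ k)) → e ≡ H (suc m) → (∀ n → H n - H (suc n) ≡ (b n + w n) + c) →
  pathEnergy F y G e ≡ (pathSum F y (λ k → b (toℕ k)) + pathSum F y (λ k → w (toℕ k))) + c * (F zero - y)
path-quadratic F y G e H b w c GH eH step = begin
  pathSum F y (λ k → G k - next G e k)
    ≡⟨ pathSum-cong F y (λ k → trans (cong₂ _-_ (GH k) (next-toℕ G e H GH eH k)) (step (toℕ k))) ⟩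
  pathSum F y (λ k → (b (toℕ k) + w (toℕ k)) + c)
    ≡⟨ pathSum-+ F y (λ k → b (toℕ k) + w (toℕ k)) (λ _ → c) ⟩
  pathSum F y (λ k → b (toℕ k) + w (toℕ k)) + pathSum F y (λ _ → c)
    ≡⟨ cong₂ _+_ (pathSum-+ F y (λ k → b (toℕ k)) (λ k → w (toℕ k))) (pathSum-const F y c) ⟩
  (pathSum F y (λ k → b (toℕ k)) + pathSum F y (λ k → w (toℕ k))) + c * (F zero - y) ∎
  where open ≡-Reasoning

-- The ear is a path of length M from its top old end to its bottom old end; the
-- position on this path is recorded by the number of edges ahead minus the
-- number of edges behind, and d is the position of the middle of the new rung.
module EarGeometry (x : Added) where
  open Added x

  d M : ℚ
  d = ι onBottom - ι onTop
  M = 3ℚ + (ι onTop + ι onBottom)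

  coordᵗ coordᵇ : ℕ → ℚ
  coordᵗ n = (d + 1ℚ) + 2ℚ * ι n
  coordᵇ n = (d - 1ℚ) - 2ℚ * ι n

  place : Ear x → ℚ
  place (top k)    = coordᵗ (toℕ k)
  place (bottom k) = coordᵇ (toℕ k)

  gap : Ear x → Ear x → ℚ
  gap (top j)    (top k)    = ι ∣ toℕ j - toℕ k ∣
  gap (top j)    (bottom k) = 1ℚ + (ι (toℕ j) + ι (toℕ k))
  gap (bottom j) (top k)    = 1ℚ + (ι (toℕ j) + ι (toℕ k))
  gap (bottom j) (bottom k) = ι ∣ toℕ j - toℕ k ∣

  -- What distances within the ear contribute to the new p and to the new ρ t + ρ s, before the
  -- quadratic correction.
  side reach : Ear x → ℚ
  side  e = gap (top zero) e - gap (bottom zero) e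
  reach e = gap (top zero) e + gap (bottom zero) e

-- D is meant to be M + ρ t s, the length of the new cycle, and i its inverse.
module Attach {A : Set} (t s : A) (ρ : A → A → ℚ) (x : Added) (D i : ℚ) where
  open Added x
  open EarGeometry x public

  r : ℚ
  r = ¼ * i

  -- As an end of the ear `t` has coordinate `M`, but `lean t` is `M - D`. The constant in `mean` is
  -- the one for which both readings give the same resistance between `u` and `t`: ρ t u - (lean u -
  -- M) / 2 - D / 4. The same constant fits at `s`.
  lean mean : A → ℚ
  lean u = ρ t u - ρ s u
  mean u = ½ * (ρ t u + ρ s u) + (½ * M - ¼ * D)

  coord : Ear x ⊎ A → ℚ
  coord (inj₁ e) = place e
  coord (inj₂ u) = lean u

  base : Ear x ⊎ A → Ear x ⊎ A → ℚ
  base (inj₁ e) (inj₁ e′) = gap e e′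
  base (inj₁ e) (inj₂ v)  = mean v
  base (inj₂ u) (inj₁ e)  = mean u
  base (inj₂ u) (inj₂ v)  = ρ u v

  ρ⁺ : Ear x ⊎ A → Ear x ⊎ A → ℚ
  ρ⁺ y z = base y z - r * ((coord y - coord z) * (coord y - coord z))

  module Sym (ρ-sym : ∀ u v → ρ u v ≡ ρ v u) (ρ-diag : ∀ u → ρ u u ≡ 0ℚ) where

    gap-sym : ∀ e e′ → gap e e′ ≡ gap e′ e
    gap-sym (top j)    (top k)    = cong ι (∣-∣-comm (toℕ j) (toℕ k))
    gap-sym (top j)    (bottom k) = solve 2 (λ j k → con 1ℚ :+ (j :+ k) := con 1ℚ :+ (k :+ j)) refl (ι (toℕ j)) (ι (toℕ k))
    gap-sym (bottom j) (top k)    = solve 2 (λ j k → con 1ℚ :+ (j :+ k) := con 1ℚ :+ (k :+ j)) refl (ι (toℕ j)) (ι (toℕ k))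
    gap-sym (bottom j) (bottom k) = cong ι (∣-∣-comm (toℕ j) (toℕ k))

    base-sym : ∀ y z → base y z ≡ base z y
    base-sym (inj₁ e) (inj₁ e′) = gap-sym e e′
    base-sym (inj₁ e) (inj₂ v)  = refl
    base-sym (inj₂ u) (inj₁ e)  = refl
    base-sym (inj₂ u) (inj₂ v)  = ρ-sym u v

    base-diag : ∀ y → base y y ≡ 0ℚ
    base-diag (inj₁ (top j))    = cong ι (∣n-n∣≡0 (toℕ j))
    base-diag (inj₁ (bottom j)) = cong ι (∣n-n∣≡0 (toℕ j))
    base-diag (inj₂ u)          = ρ-diag u

    ρ⁺-sym : ∀ y z → ρ⁺ y z ≡ ρ⁺ z y
    ρ⁺-sym y z = cong₂ (λ b q → b - r * q) (base-sym y z)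
      (solve 2 (λ y z → (y :- z) :* (y :- z) := (z :- y) :* (z :- y)) refl (coord y) (coord z))

    ρ⁺-diag : ∀ y → ρ⁺ y y ≡ 0ℚ
    ρ⁺-diag y = trans (cong (λ b → b - r * ((coord y - coord y) * (coord y - coord y))) (base-diag y))
      (solve 2 (λ y r → con 0ℚ :- r :* ((y :- y) :* (y :- y)) := con 0ℚ) refl (coord y) r)

  module Law
    (ρ-sym : ∀ u v → ρ u v ≡ ρ v u) (ρ-diag : ∀ u → ρ u u ≡ 0ℚ)
    (D≡ : ρ t s + M ≡ D) (Di≡1 : D * i ≡ 1ℚ)
    where

    lean-t : lean t ≡ M - D
    lean-t = trans (cong₂ _-_ (ρ-diag t) (ρ-sym s t)) (trans
      (solve 2 (λ R M → con 0ℚ :- R := M :- (R :+ M)) refl (ρ t s) M) (cong (λ D → M - D) D≡))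

    lean-s : lean s ≡ D - M
    lean-s = trans (cong (λ z → ρ t s - z) (ρ-diag s)) (trans
      (solve 2 (λ R M → R :- con 0ℚ := (R :+ M) :- M) refl (ρ t s) M) (cong (_- M) D≡))

    mean-t : mean t ≡ ¼ * D
    mean-t = trans (cong₂ (λ a b → ½ * (a + b) + (½ * M - ¼ * D)) (ρ-diag t) (ρ-sym s t)) (trans
      (solve 3 (λ R M D → con ½ :* (con 0ℚ :+ R) :+ (con ½ :* M :- con ¼ :* D) := con ½ :* (R :+ M) :- con ¼ :* D) refl (ρ t s) M D)
      (trans (cong (λ z → ½ * z - ¼ * D) D≡) (solve 1 (λ D → con ½ :* D :- con ¼ :* D := con ¼ :* D) refl D)))

    mean-s : mean s ≡ ¼ * D
    mean-s = trans (cong (λ b → ½ * (ρ t s + b) + (½ * M - ¼ * D)) (ρ-diag s)) (trans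
      (solve 3 (λ R M D → con ½ :* (R :+ con 0ℚ) :+ (con ½ :* M :- con ¼ :* D) := con ½ :* (R :+ M) :- con ¼ :* D) refl (ρ t s) M D)
      (trans (cong (λ z → ½ * z - ¼ * D) D≡) (solve 1 (λ D → con ½ :* D :- con ¼ :* D := con ¼ :* D) refl D)))

    -- The ring solver cannot use `D * i ≡ 1ℚ`. Identities that rest on it are proved with an
    -- explicit multiple of `D * i - 1ℚ`, which is discarded here.
    cancel : ∀ a b → a + (D * i - 1ℚ) * b ≡ a
    cancel a b = trans (cong (λ z → a + (z - 1ℚ) * b) Di≡1)
      (solve 2 (λ a b → a :+ (con 1ℚ :- con 1ℚ) :* b := a) refl a b)

    -- Going once around the new cycle shifts the coordinate by D, so the
    -- formulas on the ear and on the old network agree at t and s.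
    wrap : ∀ g → ¼ * D - r * ((g - (M - D)) * (g - (M - D))) ≡ ½ * (M - g) - r * ((g - M) * (g - M))
    wrap g = trans
      (solve 4 (λ D M i g → con ¼ :* D :- (con ¼ :* i) :* ((g :- (M :- D)) :* (g :- (M :- D)))
          := (con ½ :* (M :- g) :- (con ¼ :* i) :* ((g :- M) :* (g :- M)))
             :+ (D :* i :- con 1ℚ) :* (:- (con ½ :* (g :- M)) :- con ¼ :* D)) refl D M i g)
      (cancel _ (- (½ * (g - M)) - ¼ * D))

    wrap′ : ∀ g → ¼ * D - r * ((g - (D - M)) * (g - (D - M))) ≡ ½ * (M + g) - r * ((g + M) * (g + M))
    wrap′ g = trans
      (solve 4 (λ D M i g → con ¼ :* D :- (con ¼ :* i) :* ((g :- (D :- M)) :* (g :- (D :- M)))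
          := (con ½ :* (M :+ g) :- (con ¼ :* i) :* ((g :+ M) :* (g :+ M)))
             :+ (D :* i :- con 1ℚ) :* (con ½ :* (g :+ M) :- con ¼ :* D)) refl D M i g)
      (cancel _ (½ * (g + M) - ¼ * D))

    coordᵗ-end : coordᵗ (suc onTop) ≡ M
    coordᵗ-end = solve 2 (λ a b → ((b :- a) :+ con 1ℚ) :+ con 2ℚ :* (con 1ℚ :+ a) := con 3ℚ :+ (a :+ b)) refl (ι onTop) (ι onBottom)

    coordᵇ-end : coordᵇ (suc onBottom) ≡ - M
    coordᵇ-end = solve 2 (λ a b → ((b :- a) :- con 1ℚ) :- con 2ℚ :* (con 1ℚ :+ b) := :- (con 3ℚ :+ (a :+ b))) refl (ι onTop) (ι onBottom)

    old-at-t : ∀ u → ρ⁺ (inj₂ u) (inj₂ t) ≡ mean u - r * ((lean u - M) * (lean u - M))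
    old-at-t u = begin
      ρ u t - r * ((lean u - lean t) * (lean u - lean t))
        ≡⟨ cong₂ (λ a b → a - r * ((lean u - b) * (lean u - b))) (ρ-sym u t) lean-t ⟩
      ρ t u - r * ((lean u - (M - D)) * (lean u - (M - D)))
        ≡⟨ solve 3 (λ a D q → a :- q := (a :- con ¼ :* D) :+ (con ¼ :* D :- q)) refl
             (ρ t u) D (r * ((lean u - (M - D)) * (lean u - (M - D)))) ⟩
      (ρ t u - ¼ * D) + (¼ * D - r * ((lean u - (M - D)) * (lean u - (M - D))))
        ≡⟨ cong ((ρ t u - ¼ * D) +_) (wrap (lean u)) ⟩
      (ρ t u - ¼ * D) + (½ * (M - lean u) - r * ((lean u - M) * (lean u - M)))
        ≡⟨ solve 5 (λ a b M D q → (a :- con ¼ :* D) :+ (con ½ :* (M :- (a :- b)) :- q)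
              := (con ½ :* (a :+ b) :+ (con ½ :* M :- con ¼ :* D)) :- q) refl
             (ρ t u) (ρ s u) M D (r * ((lean u - M) * (lean u - M))) ⟩
      mean u - r * ((lean u - M) * (lean u - M)) ∎
      where open ≡-Reasoning

    old-at-s : ∀ u → ρ⁺ (inj₂ u) (inj₂ s) ≡ mean u - r * ((lean u + M) * (lean u + M))
    old-at-s u = begin
      ρ u s - r * ((lean u - lean s) * (lean u - lean s))
        ≡⟨ cong₂ (λ a b → a - r * ((lean u - b) * (lean u - b))) (ρ-sym u s) lean-s ⟩
      ρ s u - r * ((lean u - (D - M)) * (lean u - (D - M)))
        ≡⟨ solve 3 (λ a D q → a :- q := (a :- con ¼ :* D) :+ (con ¼ :* D :- q)) refl
             (ρ s u) D (r * ((lean u - (D - M)) * (lean u - (D - M)))) ⟩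
      (ρ s u - ¼ * D) + (¼ * D - r * ((lean u - (D - M)) * (lean u - (D - M))))
        ≡⟨ cong ((ρ s u - ¼ * D) +_) (wrap′ (lean u)) ⟩
      (ρ s u - ¼ * D) + (½ * (M + lean u) - r * ((lean u + M) * (lean u + M)))
        ≡⟨ solve 5 (λ a b M D q → (b :- con ¼ :* D) :+ (con ½ :* (M :+ (a :- b)) :- q)
              := (con ½ :* (a :+ b) :+ (con ½ :* M :- con ¼ :* D)) :- q) refl
             (ρ t u) (ρ s u) M D (r * ((lean u + M) * (lean u + M))) ⟩
      mean u - r * ((lean u + M) * (lean u + M)) ∎
      where open ≡-Reasoning

    ear-at-t : ∀ e → ρ⁺ (inj₁ e) (inj₂ t)
               ≡ ½ * (M - coord (inj₁ e)) - r * ((coord (inj₁ e) - M) * (coord (inj₁ e) - M))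
    ear-at-t e = trans (cong₂ (λ a b → a - r * ((coord (inj₁ e) - b) * (coord (inj₁ e) - b))) mean-t lean-t)
                       (wrap (coord (inj₁ e)))

    ear-at-s : ∀ e → ρ⁺ (inj₁ e) (inj₂ s)
               ≡ ½ * (M + coord (inj₁ e)) - r * ((coord (inj₁ e) + M) * (coord (inj₁ e) + M))
    ear-at-s e = trans (cong₂ (λ a b → a - r * ((coord (inj₁ e) - b) * (coord (inj₁ e) - b))) mean-s lean-s)
                       (wrap′ (coord (inj₁ e)))

    -- The coordinate changes by 2 along every edge, so the difference of the two squares is linear
    -- in the coordinate of the midpoint of the edge, and `r` turns into `i`. The part proportional
    -- to `g` is kept apart. On the rung, whose midpoint is `d`, the same computation gives
    -- `i * (g - d)`.
    slopeᵗ slopeᵇ : ℕ → ℚ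
    slopeᵗ n = i * (coordᵗ n + 1ℚ)
    slopeᵇ n = - (i * (coordᵇ n - 1ℚ))

    stepᵗ : ∀ (B b : ℕ → ℚ) g → (∀ n → B n - B (suc n) ≡ b n) → ∀ n →
      (B n - r * ((g - coordᵗ n) * (g - coordᵗ n))) - (B (suc n) - r * ((g - coordᵗ (suc n)) * (g - coordᵗ (suc n))))
      ≡ (b n + slopeᵗ n) + - (i * g)
    stepᵗ B b g Bb n = trans
      (solve 6 (λ B B′ g i c n →
          (B :- (con ¼ :* i) :* ((g :- (c :+ con 2ℚ :* n)) :* (g :- (c :+ con 2ℚ :* n))))
            :- (B′ :- (con ¼ :* i) :* ((g :- (c :+ con 2ℚ :* (con 1ℚ :+ n))) :* (g :- (c :+ con 2ℚ :* (con 1ℚ :+ n)))))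
          := ((B :- B′) :+ i :* ((c :+ con 2ℚ :* n) :+ con 1ℚ)) :+ :- (i :* g)) refl
        (B n) (B (suc n)) g i (d + 1ℚ) (ι n))
      (cong (λ z → (z + slopeᵗ n) + - (i * g)) (Bb n))

    stepᵇ : ∀ (B b : ℕ → ℚ) g → (∀ n → B n - B (suc n) ≡ b n) → ∀ n →
      (B n - r * ((g - coordᵇ n) * (g - coordᵇ n))) - (B (suc n) - r * ((g - coordᵇ (suc n)) * (g - coordᵇ (suc n))))
      ≡ (b n + slopeᵇ n) + i * g
    stepᵇ B b g Bb n = trans
      (solve 6 (λ B B′ g i c n →
          (B :- (con ¼ :* i) :* ((g :- (c :- con 2ℚ :* n)) :* (g :- (c :- con 2ℚ :* n))))
            :- (B′ :- (con ¼ :* i) :* ((g :- (c :- con 2ℚ :* (con 1ℚ :+ n))) :* (g :- (c :- con 2ℚ :* (con 1ℚ :+ n)))))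
          := ((B :- B′) :+ :- (i :* ((c :- con 2ℚ :* n) :- con 1ℚ))) :+ i :* g) refl
        (B n) (B (suc n)) g i (d - 1ℚ) (ι n))
      (cong (λ z → (z + slopeᵇ n) + i * g) (Bb n))

    module _ (F : Fin (suc onTop) → ℚ) (y : ℚ) where
      Wᵗ : ℚ
      Wᵗ = pathSum F y (λ k → slopeᵗ (toℕ k))

      energyᵗ : Ear x ⊎ A → ℚ
      energyᵗ z = pathEnergy F y (λ k → ρ⁺ z (inj₁ (top k))) (ρ⁺ z (inj₂ t))

      -- Here and in the next lemmas the slope of `base` is 0 as seen from an old vertex, because
      -- `mean` ignores the place on the ear; a kink as seen from the same arm; and -1 as seen from
      -- the other arm, where the distance grows by one per edge.
      energyᵗ-old : ∀ u → energyᵗ (inj₂ u) ≡ (0ℚ * (F zero - y) + Wᵗ) + - (i * lean u) * (F zero - y)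
      energyᵗ-old u = trans
        (path-quadratic F y _ _ (λ n → mean u - r * ((lean u - coordᵗ n) * (lean u - coordᵗ n)))
          (λ _ → 0ℚ) slopeᵗ (- (i * lean u)) (λ _ → refl)
          (trans (old-at-t u) (cong (λ c → mean u - r * ((lean u - c) * (lean u - c))) (sym coordᵗ-end)))
          (stepᵗ (λ _ → mean u) (λ _ → 0ℚ) (lean u) (λ _ → solve 1 (λ a → a :- a := con 0ℚ) refl (mean u))))
        (cong (λ z → (z + Wᵗ) + - (i * lean u) * (F zero - y)) (pathSum-const F y 0ℚ))

      energyᵗ-top : ∀ j → let g = coordᵗ (toℕ j) in
        energyᵗ (inj₁ (top j)) ≡ (((F zero - F j) - (F j - y)) + Wᵗ) + - (i * g) * (F zero - y)
      energyᵗ-top j = trans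
        (path-quadratic F y _ _ (λ n → ι ∣ toℕ j - n ∣ - r * ((g - coordᵗ n) * (g - coordᵗ n)))
          (kink (toℕ j)) slopeᵗ (- (i * g)) (λ _ → refl)
          (trans (ear-at-t (top j))
            (cong₂ (λ a c → a - r * ((g - c) * (g - c)))
              (trans (solve 3 (λ a b j → con ½ :* ((con 3ℚ :+ (a :+ b)) :- (((b :- a) :+ con 1ℚ) :+ con 2ℚ :* j))
                        := (con 1ℚ :+ a) :- j) refl (ι onTop) (ι onBottom) (ι (toℕ j)))
                     (sym (ι-gap-end j)))
              (sym coordᵗ-end)))
          (stepᵗ (λ n → ι ∣ toℕ j - n ∣) (kink (toℕ j)) g (ι-gap-kink (toℕ j))))
        (cong (λ z → (z + Wᵗ) + - (i * g) * (F zero - y)) (pathSum-kink F y j))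
        where
        g : ℚ
        g = coordᵗ (toℕ j)

      energyᵗ-bottom : ∀ j → let g = coordᵇ (toℕ j) in
        energyᵗ (inj₁ (bottom j)) ≡ (- 1ℚ * (F zero - y) + Wᵗ) + - (i * g) * (F zero - y)
      energyᵗ-bottom j = trans
        (path-quadratic F y _ _ (λ n → (1ℚ + (ι (toℕ j) + ι n)) - r * ((g - coordᵗ n) * (g - coordᵗ n)))
          (λ _ → - 1ℚ) slopeᵗ (- (i * g)) (λ _ → refl)
          (trans (ear-at-t (bottom j))
            (cong₂ (λ a c → a - r * ((g - c) * (g - c)))
              (solve 3 (λ a b j → con ½ :* ((con 3ℚ :+ (a :+ b)) :- (((b :- a) :- con 1ℚ) :- con 2ℚ :* j))
                        := con 1ℚ :+ (j :+ (con 1ℚ :+ a))) refl (ι onTop) (ι onBottom) (ι (toℕ j)))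
              (sym coordᵗ-end)))
          (stepᵗ (λ n → 1ℚ + (ι (toℕ j) + ι n)) (λ _ → - 1ℚ) g
            (λ n → solve 2 (λ j n → (con 1ℚ :+ (j :+ n)) :- (con 1ℚ :+ (j :+ (con 1ℚ :+ n))) := :- con 1ℚ) refl (ι (toℕ j)) (ι n))))
        (cong (λ z → (z + Wᵗ) + - (i * g) * (F zero - y)) (pathSum-const F y (- 1ℚ)))
        where
        g : ℚ
        g = coordᵇ (toℕ j)

    module _ (F : Fin (suc onBottom) → ℚ) (y : ℚ) where
      Wᵇ : ℚ
      Wᵇ = pathSum F y (λ k → slopeᵇ (toℕ k))

      energyᵇ : Ear x ⊎ A → ℚ
      energyᵇ z = pathEnergy F y (λ k → ρ⁺ z (inj₁ (bottom k))) (ρ⁺ z (inj₂ s))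

      minus-neg : ∀ B g → B - r * ((g + M) * (g + M)) ≡ B - r * ((g - coordᵇ (suc onBottom)) * (g - coordᵇ (suc onBottom)))
      minus-neg B g = trans
        (solve 4 (λ B r g M → B :- r :* ((g :+ M) :* (g :+ M)) := B :- r :* ((g :- (:- M)) :* (g :- (:- M)))) refl B r g M)
        (cong (λ c → B - r * ((g - c) * (g - c))) (sym coordᵇ-end))

      energyᵇ-old : ∀ u → energyᵇ (inj₂ u) ≡ (0ℚ * (F zero - y) + Wᵇ) + (i * lean u) * (F zero - y)
      energyᵇ-old u = trans
        (path-quadratic F y _ _ (λ n → mean u - r * ((lean u - coordᵇ n) * (lean u - coordᵇ n)))
          (λ _ → 0ℚ) slopeᵇ (i * lean u) (λ _ → refl)
          (trans (old-at-s u) (minus-neg (mean u) (lean u)))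
          (stepᵇ (λ _ → mean u) (λ _ → 0ℚ) (lean u) (λ _ → solve 1 (λ a → a :- a := con 0ℚ) refl (mean u))))
        (cong (λ z → (z + Wᵇ) + (i * lean u) * (F zero - y)) (pathSum-const F y 0ℚ))

      energyᵇ-bottom : ∀ j → let g = coordᵇ (toℕ j) in
        energyᵇ (inj₁ (bottom j)) ≡ (((F zero - F j) - (F j - y)) + Wᵇ) + (i * g) * (F zero - y)
      energyᵇ-bottom j = trans
        (path-quadratic F y _ _ (λ n → ι ∣ toℕ j - n ∣ - r * ((g - coordᵇ n) * (g - coordᵇ n)))
          (kink (toℕ j)) slopeᵇ (i * g) (λ _ → refl)
          (trans (ear-at-s (bottom j)) (trans
            (cong (λ a → a - r * ((g + M) * (g + M)))
              (trans (solve 3 (λ a b j → con ½ :* ((con 3ℚ :+ (a :+ b)) :+ (((b :- a) :- con 1ℚ) :- con 2ℚ :* j))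
                        := (con 1ℚ :+ b) :- j) refl (ι onTop) (ι onBottom) (ι (toℕ j)))
                     (sym (ι-gap-end j))))
            (minus-neg (ι ∣ toℕ j - suc onBottom ∣) g)))
          (stepᵇ (λ n → ι ∣ toℕ j - n ∣) (kink (toℕ j)) g (ι-gap-kink (toℕ j))))
        (cong (λ z → (z + Wᵇ) + (i * g) * (F zero - y)) (pathSum-kink F y j))
        where
        g : ℚ
        g = coordᵇ (toℕ j)

      energyᵇ-top : ∀ j → let g = coordᵗ (toℕ j) in
        energyᵇ (inj₁ (top j)) ≡ (- 1ℚ * (F zero - y) + Wᵇ) + (i * g) * (F zero - y)
      energyᵇ-top j = trans
        (path-quadratic F y _ _ (λ n → (1ℚ + (ι (toℕ j) + ι n)) - r * ((g - coordᵇ n) * (g - coordᵇ n)))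
          (λ _ → - 1ℚ) slopeᵇ (i * g) (λ _ → refl)
          (trans (ear-at-s (top j)) (trans
            (cong (λ a → a - r * ((g + M) * (g + M)))
              (solve 3 (λ a b j → con ½ :* ((con 3ℚ :+ (a :+ b)) :+ (((b :- a) :+ con 1ℚ) :+ con 2ℚ :* j))
                        := con 1ℚ :+ (j :+ (con 1ℚ :+ b))) refl (ι onTop) (ι onBottom) (ι (toℕ j))))
            (minus-neg (1ℚ + (ι (toℕ j) + (1ℚ + ι onBottom))) g)))
          (stepᵇ (λ n → 1ℚ + (ι (toℕ j) + ι n)) (λ _ → - 1ℚ) g
            (λ n → solve 2 (λ j n → (con 1ℚ :+ (j :+ n)) :- (con 1ℚ :+ (j :+ (con 1ℚ :+ n))) := :- con 1ℚ) refl (ι (toℕ j)) (ι n))))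
        (cong (λ z → (z + Wᵇ) + (i * g) * (F zero - y)) (pathSum-const F y (- 1ℚ)))
        where
        g : ℚ
        g = coordᵗ (toℕ j)

    rung-step : ∀ B B′ g →
      (B - r * ((g - coordᵗ 0) * (g - coordᵗ 0))) - (B′ - r * ((g - coordᵇ 0) * (g - coordᵇ 0)))
      ≡ (B - B′) + i * (g - d)
    rung-step B B′ g = solve 5 (λ B B′ g i d →
        (B :- (con ¼ :* i) :* ((g :- ((d :+ con 1ℚ) :+ con 2ℚ :* con 0ℚ)) :* (g :- ((d :+ con 1ℚ) :+ con 2ℚ :* con 0ℚ))))
          :- (B′ :- (con ¼ :* i) :* ((g :- ((d :- con 1ℚ) :- con 2ℚ :* con 0ℚ)) :* (g :- ((d :- con 1ℚ) :- con 2ℚ :* con 0ℚ))))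
        := (B :- B′) :+ i :* (g :- d)) refl B B′ g i d

    -- The old network is represented by its energy alone: a functional that is linear in its second
    -- argument, vanishes on constants and satisfies the law of ρ.
    module Form
      (EA : (A → ℚ) → (A → ℚ) → ℚ)
      (EA-cong : ∀ f {g h} → (∀ v → g v ≡ h v) → EA f g ≡ EA f h)
      (EA-lin : ∀ f c cs → EA f (λ v → c + lin cs v) ≡ linOf (EA f) cs)
      (law : ∀ f u v → EA f (ρ u) + (f u + f u) ≡ EA f (ρ v) + (f v + f v))
      (f : Ear x ⊎ A → ℚ)
      where

      f₂ : A → ℚ
      f₂ v = f (inj₂ v)
      Fᵗ : Fin (suc onTop) → ℚ
      Fᵗ k = f (inj₁ (top k))
      Fᵇ : Fin (suc onBottom) → ℚ
      Fᵇ k = f (inj₁ (bottom k))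

      K P² : ℚ
      K  = EA f₂ (ρ t) + (f₂ t + f₂ t)
      P² = EA f₂ (λ v → lean v * lean v)

      EA-at : ∀ u → EA f₂ (ρ u) ≡ K - (f₂ u + f₂ u)
      EA-at u = trans
        (solve 2 (λ a b → a := (a :+ b) :- b) refl (EA f₂ (ρ u)) (f₂ u + f₂ u))
        (cong (_- (f₂ u + f₂ u)) (law f₂ u t))

      -- Expanding the square gives `ρ t` and `ρ s` opposite coefficients, so `K` cancels between
      -- them and only `f₂ s - f₂ t` remains. The energy `P²` of the squared lean is left
      -- unevaluated, which is harmless since it does not depend on `u`.
      old-part : ∀ u → EA f₂ (λ v → ρ⁺ (inj₂ u) (inj₂ v))
        ≡ ((K - (f₂ u + f₂ u)) - r * P²) + (i * lean u) * (f₂ s - f₂ t)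
      old-part u = begin
        EA f₂ (λ v → ρ⁺ (inj₂ u) (inj₂ v))
          ≡⟨ EA-cong f₂ (λ v → solve 5 (λ ρ p r a b → ρ :- r :* ((p :- (a :- b)) :* (p :- (a :- b)))
               := :- (r :* (p :* p)) :+ (con 1ℚ :* ρ :+ (:- r :* ((a :- b) :* (a :- b))
                    :+ ((con 2ℚ :* (r :* p)) :* a :+ (:- (con 2ℚ :* (r :* p)) :* b :+ con 0ℚ))))) refl
               (ρ u v) (lean u) r (ρ t v) (ρ s v)) ⟩
        EA f₂ (λ v → - (r * (lean u * lean u)) + lin cs v)
          ≡⟨ EA-lin f₂ (- (r * (lean u * lean u))) cs ⟩
        1ℚ * EA f₂ (ρ u) + (- r * P² + (2ℚ * (r * lean u) * EA f₂ (ρ t)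
          + (- (2ℚ * (r * lean u)) * EA f₂ (ρ s) + 0ℚ)))
          ≡⟨ cong₂ (λ a b → 1ℚ * a + (- r * P² + b)) (EA-at u)
               (cong₂ (λ a b → 2ℚ * (r * lean u) * a + (- (2ℚ * (r * lean u)) * b + 0ℚ)) (EA-at t) (EA-at s)) ⟩
        1ℚ * (K - (f₂ u + f₂ u)) + (- r * P² + (2ℚ * (r * lean u) * (K - (f₂ t + f₂ t))
          + (- (2ℚ * (r * lean u)) * (K - (f₂ s + f₂ s)) + 0ℚ)))
          ≡⟨ solve 7 (λ K fu i P p ft fs →
               con 1ℚ :* (K :- (fu :+ fu)) :+ (:- (con ¼ :* i) :* P
                 :+ (con 2ℚ :* ((con ¼ :* i) :* p) :* (K :- (ft :+ ft))
                 :+ (:- (con 2ℚ :* ((con ¼ :* i) :* p)) :* (K :- (fs :+ fs)) :+ con 0ℚ)))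
               := ((K :- (fu :+ fu)) :- (con ¼ :* i) :* P) :+ (i :* p) :* (fs :- ft)) refl
               K (f₂ u) i P² (lean u) (f₂ t) (f₂ s) ⟩
        ((K - (f₂ u + f₂ u)) - r * P²) + (i * lean u) * (f₂ s - f₂ t) ∎
        where
        open ≡-Reasoning
        cs : List (ℚ × (A → ℚ))
        cs = (1ℚ , ρ u) ∷ (- r , λ v → lean v * lean v)
             ∷ (2ℚ * (r * lean u) , ρ t) ∷ (- (2ℚ * (r * lean u)) , ρ s) ∷ []

      ear-part : ∀ e → EA f₂ (λ v → ρ⁺ (inj₁ e) (inj₂ v))
        ≡ ((K - (f₂ t + f₂ s)) - r * P²) + (i * coord (inj₁ e)) * (f₂ s - f₂ t)
      ear-part e = begin
        EA f₂ (λ v → ρ⁺ (inj₁ e) (inj₂ v))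
          ≡⟨ EA-cong f₂ (λ v → solve 5 (λ c p r a b → (con ½ :* (a :+ b) :+ c) :- r :* ((p :- (a :- b)) :* (p :- (a :- b)))
               := (c :- r :* (p :* p)) :+ (:- r :* ((a :- b) :* (a :- b))
                    :+ ((con ½ :+ con 2ℚ :* (r :* p)) :* a :+ ((con ½ :- con 2ℚ :* (r :* p)) :* b :+ con 0ℚ)))) refl
               (½ * M - ¼ * D) q r (ρ t v) (ρ s v)) ⟩
        EA f₂ (λ v → ((½ * M - ¼ * D) - r * (q * q)) + lin cs v)
          ≡⟨ EA-lin f₂ ((½ * M - ¼ * D) - r * (q * q)) cs ⟩
        - r * P² + ((½ + 2ℚ * (r * q)) * EA f₂ (ρ t) + ((½ - 2ℚ * (r * q)) * EA f₂ (ρ s) + 0ℚ))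
          ≡⟨ cong (- r * P² +_)
               (cong₂ (λ a b → (½ + 2ℚ * (r * q)) * a + ((½ - 2ℚ * (r * q)) * b + 0ℚ)) (EA-at t) (EA-at s)) ⟩
        - r * P² + ((½ + 2ℚ * (r * q)) * (K - (f₂ t + f₂ t)) + ((½ - 2ℚ * (r * q)) * (K - (f₂ s + f₂ s)) + 0ℚ))
          ≡⟨ solve 6 (λ K i P p ft fs →
               :- (con ¼ :* i) :* P
                 :+ ((con ½ :+ con 2ℚ :* ((con ¼ :* i) :* p)) :* (K :- (ft :+ ft))
                 :+ ((con ½ :- con 2ℚ :* ((con ¼ :* i) :* p)) :* (K :- (fs :+ fs)) :+ con 0ℚ))
               := ((K :- (ft :+ fs)) :- (con ¼ :* i) :* P) :+ (i :* p) :* (fs :- ft)) refl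
               K i P² q (f₂ t) (f₂ s) ⟩
        ((K - (f₂ t + f₂ s)) - r * P²) + (i * q) * (f₂ s - f₂ t) ∎
        where
        open ≡-Reasoning
        q : ℚ
        q = coord (inj₁ e)
        cs : List (ℚ × (A → ℚ))
        cs = (- r , λ v → lean v * lean v) ∷ (½ + 2ℚ * (r * q) , ρ t) ∷ (½ - 2ℚ * (r * q) , ρ s) ∷ []

      E⁺ : (Ear x ⊎ A → ℚ) → ℚ
      E⁺ h = EA f₂ (λ v → h (inj₂ v))
        + ((pathEnergy Fᵗ (f₂ t) (λ k → h (inj₁ (top k))) (h (inj₂ t))
            + pathEnergy Fᵇ (f₂ s) (λ k → h (inj₁ (bottom k))) (h (inj₂ s)))
           + (Fᵗ zero - Fᵇ zero) * (h (inj₁ (top zero)) - h (inj₁ (bottom zero))))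

      κ wᵗ wᵇ : ℚ
      wᵗ = Wᵗ Fᵗ (f₂ t)
      wᵇ = Wᵇ Fᵇ (f₂ s)
      κ = ((K - r * P²) + (wᵗ + wᵇ)) - (i * d) * (Fᵗ zero - Fᵇ zero)

      -- The terms with `i * coord z` form a circulation round the new cycle, through the old
      -- network, both arms and the rung, and telescope to zero. What else depends on `z` is -2
      -- `f z`, from `EA-at` for an old vertex and from the kink for a vertex of the ear.
      law⁺ : ∀ z → E⁺ (ρ⁺ z) + (f z + f z) ≡ κ
      law⁺ (inj₂ u) = trans
        (cong (_+ (f₂ u + f₂ u)) (cong₂ _+_ (old-part u)
          (cong₂ _+_ (cong₂ _+_ (energyᵗ-old Fᵗ (f₂ t) u) (energyᵇ-old Fᵇ (f₂ s) u))
            (cong ((Fᵗ zero - Fᵇ zero) *_) (rung-step (mean u) (mean u) (lean u))))))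
        (solve 13 (λ K P fu ft fs p i d wt wb Ft Fb m →
           (((((K :- (fu :+ fu)) :- (con ¼ :* i) :* P) :+ (i :* p) :* (fs :- ft))
             :+ ((((con 0ℚ :* (Ft :- ft) :+ wt) :+ :- (i :* p) :* (Ft :- ft))
                  :+ ((con 0ℚ :* (Fb :- fs) :+ wb) :+ (i :* p) :* (Fb :- fs)))
                 :+ (Ft :- Fb) :* ((m :- m) :+ i :* (p :- d)))) :+ (fu :+ fu))
           := ((K :- (con ¼ :* i) :* P) :+ (wt :+ wb)) :- (i :* d) :* (Ft :- Fb)) refl
          K P² (f₂ u) (f₂ t) (f₂ s) (lean u) i d wᵗ wᵇ (Fᵗ zero) (Fᵇ zero) (mean u))
      law⁺ (inj₁ (top j)) = trans
        (cong (_+ (Fᵗ j + Fᵗ j)) (cong₂ _+_ (ear-part (top j))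
          (cong₂ _+_ (cong₂ _+_ (energyᵗ-top Fᵗ (f₂ t) j) (energyᵇ-top Fᵇ (f₂ s) j))
            (cong ((Fᵗ zero - Fᵇ zero) *_) (trans
              (rung-step (ι ∣ toℕ j - 0 ∣) (1ℚ + (ι (toℕ j) + 0ℚ)) (coordᵗ (toℕ j)))
              (cong (λ n → (ι n - (1ℚ + (ι (toℕ j) + 0ℚ))) + i * (coordᵗ (toℕ j) - d)) (∣-∣-identityʳ (toℕ j))))))))
        (solve 13 (λ K P fu ft fs p i d wt wb Ft Fb m →
           (((((K :- (ft :+ fs)) :- (con ¼ :* i) :* P) :+ (i :* p) :* (fs :- ft))
             :+ (((((Ft :- fu) :- (fu :- ft)) :+ wt) :+ :- (i :* p) :* (Ft :- ft))
                  :+ ((:- con 1ℚ :* (Fb :- fs) :+ wb) :+ (i :* p) :* (Fb :- fs))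
                 :+ (Ft :- Fb) :* ((m :- (con 1ℚ :+ (m :+ con 0ℚ))) :+ i :* (p :- d)))) :+ (fu :+ fu))
           := ((K :- (con ¼ :* i) :* P) :+ (wt :+ wb)) :- (i :* d) :* (Ft :- Fb)) refl
          K P² (Fᵗ j) (f₂ t) (f₂ s) (coordᵗ (toℕ j)) i d wᵗ wᵇ (Fᵗ zero) (Fᵇ zero) (ι (toℕ j)))
      law⁺ (inj₁ (bottom j)) = trans
        (cong (_+ (Fᵇ j + Fᵇ j)) (cong₂ _+_ (ear-part (bottom j))
          (cong₂ _+_ (cong₂ _+_ (energyᵗ-bottom Fᵗ (f₂ t) j) (energyᵇ-bottom Fᵇ (f₂ s) j))
            (cong ((Fᵗ zero - Fᵇ zero) *_) (trans
              (rung-step (1ℚ + (ι (toℕ j) + 0ℚ)) (ι ∣ toℕ j - 0 ∣) (coordᵇ (toℕ j)))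
              (cong (λ n → ((1ℚ + (ι (toℕ j) + 0ℚ)) - ι n) + i * (coordᵇ (toℕ j) - d)) (∣-∣-identityʳ (toℕ j))))))))
        (solve 13 (λ K P fu ft fs p i d wt wb Ft Fb m →
           (((((K :- (ft :+ fs)) :- (con ¼ :* i) :* P) :+ (i :* p) :* (fs :- ft))
             :+ (((:- con 1ℚ :* (Ft :- ft) :+ wt) :+ :- (i :* p) :* (Ft :- ft))
                  :+ ((((Fb :- fu) :- (fu :- fs)) :+ wb) :+ (i :* p) :* (Fb :- fs))
                 :+ (Ft :- Fb) :* (((con 1ℚ :+ (m :+ con 0ℚ)) :- m) :+ i :* (p :- d)))) :+ (fu :+ fu))
           := ((K :- (con ¼ :* i) :* P) :+ (wt :+ wb)) :- (i :* d) :* (Ft :- Fb)) refl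
          K P² (Fᵇ j) (f₂ t) (f₂ s) (coordᵇ (toℕ j)) i d wᵗ wᵇ (Fᵗ zero) (Fᵇ zero) (ι (toℕ j)))

-- End resistances and the resistance function of a chain.

ι≥0 : ∀ n → 0ℚ ≤ ι n
ι≥0 zero    = ≤-refl
ι≥0 (suc n) = +-mono-≤ {0ℚ} {1ℚ} (nonNegative⁻¹ 1ℚ) (ι≥0 n)

-- The lower bound keeps `D` at least 1 and hence invertible; the upper bound is used for the sign
-- of m.
record EndResistance : Set where
  field
    R   : ℚ
    0≤R : 0ℚ ≤ R
    R≤1 : R ≤ 1ℚ

module Cycle (x : Added) (E : EndResistance) where
  open EndResistance E

  D : ℚ
  D = R + EarGeometry.M x

  1≤D : 1ℚ ≤ D
  1≤D = +-mono-≤ {0ℚ} {R} {1ℚ} {EarGeometry.M x} 0≤R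
    (+-mono-≤ {1ℚ} {3ℚ} {0ℚ} {ι (Added.onTop x) + ι (Added.onBottom x)} (+-monoʳ-≤ 1ℚ {0ℚ} {2ℚ} (nonNegative⁻¹ 2ℚ))
      (+-mono-≤ {0ℚ} {_} {0ℚ} (ι≥0 (Added.onTop x)) (ι≥0 (Added.onBottom x))))

  D-positive : Positive D
  D-positive = positive (<-≤-trans (positive⁻¹ 1ℚ) 1≤D)

  i : ℚ
  i = (1/ D) {{pos⇒nonZero D {{D-positive}}}}

  D*i≡1 : D * i ≡ 1ℚ
  D*i≡1 = *-inverseʳ D {{pos⇒nonZero D {{D-positive}}}}

  i-nonNegative : NonNegative i
  i-nonNegative = pos⇒nonNeg i {{1/pos⇒pos D {{D-positive}}}}

  0≤i : 0ℚ ≤ i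
  0≤i = nonNegative⁻¹ i {{i-nonNegative}}

  i≤1 : i ≤ 1ℚ
  i≤1 = subst₂ _≤_ (*-identityˡ i) D*i≡1 (*-monoʳ-≤-nonNeg i {{i-nonNegative}} 1≤D)

  newEnds : EndResistance
  newEnds = record
    -- The new unit rung is in parallel with the other D - 1 units of the cycle, and (D - 1) / D = 1
    -- - 1 / D.
    { R   = 1ℚ - i
    ; 0≤R = subst (_≤ 1ℚ - i) (+-inverseʳ i) (+-monoˡ-≤ (- i) i≤1)
    ; R≤1 = subst (1ℚ - i ≤_) (+-identityʳ 1ℚ) (+-monoʳ-≤ 1ℚ (neg-antimono-≤ 0≤i))
    }

endResistance : ∀ {L} → Vec Added L → EndResistance
endResistance []       = record { R = 1ℚ ; 0≤R = nonNegative⁻¹ 1ℚ ; R≤1 = ≤-refl }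
endResistance (x ∷ as) = Cycle.newEnds x (endResistance as)

endTop endBottom : ∀ {L} (as : Vec Added L) → ChainV as
endTop    as = inj₁ (top zero)
endBottom as = inj₁ (bottom zero)

-- A single rung has resistances 0 and 1 only. As squared differences of heights they are symmetric,
-- and zero on the diagonal, by ring identities.
height : ChainV [] → ℚ
height (inj₁ (top _))    = 0ℚ
height (inj₁ (bottom _)) = 1ℚ
height (inj₂ (rung zero , ()))

chainρ : ∀ {L} (as : Vec Added L) → ChainV as → ChainV as → ℚ
chainρ []       u v = (height u - height v) * (height u - height v)
chainρ (x ∷ as) u v = Attach.ρ⁺ (endTop as) (endBottom as) (chainρ as) x (Cycle.D x (endResistance as)) (Cycle.i x (endResistance as))
                        (split x as u) (split x as v)

chainρ-ends : ∀ {L} (as : Vec Added L) → chainρ as (endTop as) (endBottom as) ≡ EndResistance.R (endResistance as)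
chainρ-ends []       = refl
chainρ-ends (x ∷ as) = solve 2 (λ d i →
    (con 1ℚ :+ (con 0ℚ :+ con 0ℚ)) :- (con ¼ :* i) :*
      ((((d :+ con 1ℚ) :+ con 2ℚ :* con 0ℚ) :- ((d :- con 1ℚ) :- con 2ℚ :* con 0ℚ))
       :* (((d :+ con 1ℚ) :+ con 2ℚ :* con 0ℚ) :- ((d :- con 1ℚ) :- con 2ℚ :* con 0ℚ)))
    := con 1ℚ :- i) refl
  (ι (Added.onBottom x) - ι (Added.onTop x)) (Cycle.i x (endResistance as))

chain-isResistance : ∀ {L} (as : Vec Added L) → Energy.IsResistance (chain as) (chainρ as)
chain-isResistance [] = record
  { ρ-sym  = λ u v → solve 2 (λ u v → (u :- v) :* (u :- v) := (v :- u) :* (v :- u)) refl (height u) (height v)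
  ; ρ-diag = λ u → solve 1 (λ u → (u :- u) :* (u :- u) := con 0ℚ) refl (height u)
  ; ρ-law  = λ f u v → trans (law f u) (sym (law f v))
  }
  where
  law : ∀ f u → Energy.energy (chain []) f (chainρ [] u) + (f u + f u) ≡ f (endTop []) + f (endBottom [])
  law f (inj₁ (top zero))    = solve 2 (λ t s → ((t :- s) :* con (- 1ℚ) :+ con 0ℚ) :+ (t :+ t) := t :+ s) refl
    (f (endTop [])) (f (endBottom []))
  law f (inj₁ (bottom zero)) = solve 2 (λ t s → ((t :- s) :* con 1ℚ :+ con 0ℚ) :+ (s :+ s) := t :+ s) refl
    (f (endTop [])) (f (endBottom []))
  law f (inj₂ (rung zero , ()))
chain-isResistance (x ∷ as) = record
  { ρ-sym  = λ u v → S.ρ⁺-sym (split x as u) (split x as v)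
  ; ρ-diag = λ u → S.ρ⁺-diag (split x as u)
  ; ρ-law  = λ f u v → trans (law f u) (sym (law f v))
  }
  where
  open Energy.IsResistance (chain-isResistance as)
  E : EndResistance
  E = endResistance as
  module At = Attach (endTop as) (endBottom as) (chainρ as) x (Cycle.D x E) (Cycle.i x E)
  module S = At.Sym ρ-sym ρ-diag
  module Law = At.Law ρ-sym ρ-diag (cong (_+ EarGeometry.M x) (chainρ-ends as)) (Cycle.D*i≡1 x E)
  module Fm (f : ChainV (x ∷ as) → ℚ) = Law.Form (Energy.energy (chain as)) (Energy.energy-cong (chain as))
    (Energy.energy-lin (chain as)) ρ-law (λ z → f (join x as z))

  E⁺-cong : ∀ f {g h} → (∀ z → g z ≡ h z) → Fm.E⁺ f g ≡ Fm.E⁺ f h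
  E⁺-cong f {g} {h} eq = cong₂ _+_
    (Energy.energy-cong (chain as) (Fm.f₂ f) (λ v → eq (inj₂ v)))
    (cong₂ _+_
      (cong₂ _+_
        (trans (pathEnergy-cong (Fm.Fᵗ f) (Fm.Fᵗ f) (λ k → g (inj₁ (top k))) (λ k → h (inj₁ (top k)))
                 (Fm.f₂ f (endTop as)) (g (inj₂ (endTop as))) (λ _ → refl) (λ k → eq (inj₁ (top k))))
               (cong (pathEnergy (Fm.Fᵗ f) (Fm.f₂ f (endTop as)) (λ k → h (inj₁ (top k)))) (eq (inj₂ (endTop as)))))
        (trans (pathEnergy-cong (Fm.Fᵇ f) (Fm.Fᵇ f) (λ k → g (inj₁ (bottom k))) (λ k → h (inj₁ (bottom k)))
                 (Fm.f₂ f (endBottom as)) (g (inj₂ (endBottom as))) (λ _ → refl) (λ k → eq (inj₁ (bottom k))))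
               (cong (pathEnergy (Fm.Fᵇ f) (Fm.f₂ f (endBottom as)) (λ k → h (inj₁ (bottom k)))) (eq (inj₂ (endBottom as))))))
      (cong₂ (λ a b → (Fm.Fᵗ f zero - Fm.Fᵇ f zero) * (a - b)) (eq (inj₁ (top zero))) (eq (inj₁ (bottom zero)))))

  law : ∀ f u → Energy.energy (chain (x ∷ as)) f (chainρ (x ∷ as) u) + (f u + f u) ≡ Fm.κ f
  law f u = trans
    (cong₂ _+_
      (trans (energy-split x as f (chainρ (x ∷ as) u))
             (E⁺-cong f (λ z → cong (At.ρ⁺ (split x as u)) (split-join x as z))))
      (cong (λ v → f v + f v) (sym (join-split x as u))))
    (Fm.law⁺ f (split x as u))

-- Moments of an ear and the recursion for the vertex sums.

-- The parameters belong to the polygon and are shared by all its orientations; the orientation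
-- appears through `d` alone. This is what confines `d` in the recursion.
record EarSums (x : Added) (s s₂ s₃ s₄ : ℚ) : Set where
  open EarGeometry x

  field
    M≡s+1       : M ≡ s + 1ℚ
    ∑-1         : ∑ (ears x) (λ _ → 1ℚ) ≡ s
    ∑-place     : ∑ (ears x) place ≡ 0ℚ
    ∑-place²    : ∑ (ears x) (λ e → place e * place e) ≡ s₂
    ∑-side      : ∑ (ears x) side ≡ d
    ∑-side²     : ∑ (ears x) (λ e → side e * side e) ≡ s
    ∑-sideplace : ∑ (ears x) (λ e → side e * place e) ≡ ½ * (d * d) - s₃
    ∑-reach     : ∑ (ears x) reach ≡ ½ * (d * d) + s₃
    ∑-gap       : ∑ (ears x) (λ e → ∑ (ears x) (gap e)) ≡ s₄

squareSums : EarSums unchanged 2ℚ 2ℚ 2ℚ 2ℚ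
squareSums = record
  { M≡s+1 = refl ; ∑-1 = refl ; ∑-place = refl ; ∑-place² = refl ; ∑-side = refl
  ; ∑-side² = refl ; ∑-sideplace = refl ; ∑-reach = refl ; ∑-gap = refl }

4ℚ 8ℚ 20ℚ : ℚ
4ℚ  = ℤ.+ 4 / 1
8ℚ  = ℤ.+ 8 / 1
20ℚ = ℤ.+ 20 / 1

-- In every orientation the ear is a path on four vertices with places 3, 1, -1, -3. So `s₂` is 9 +
-- 1 + 1 + 9, and `s₄` is twice the sum 10 of the distances in that path.
hexagonSums : ∀ a → EarSums (innerHexagon a) 4ℚ 20ℚ 8ℚ 20ℚ
hexagonSums zero = record
  { M≡s+1 = refl ; ∑-1 = refl ; ∑-place = refl ; ∑-place² = refl ; ∑-side = refl
  ; ∑-side² = refl ; ∑-sideplace = refl ; ∑-reach = refl ; ∑-gap = refl }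
hexagonSums (suc zero) = record
  { M≡s+1 = refl ; ∑-1 = refl ; ∑-place = refl ; ∑-place² = refl ; ∑-side = refl
  ; ∑-side² = refl ; ∑-sideplace = refl ; ∑-reach = refl ; ∑-gap = refl }
hexagonSums (suc (suc zero)) = record
  { M≡s+1 = refl ; ∑-1 = refl ; ∑-place = refl ; ∑-place² = refl ; ∑-side = refl
  ; ∑-side² = refl ; ∑-sideplace = refl ; ∑-reach = refl ; ∑-gap = refl }

∑∑-affine : {X Y : Set} (xs : List X) (ys : List Y) (b c : X → Y → ℚ) (r : ℚ) →
  ∑ xs (λ x → ∑ ys (λ y → b x y - r * c x y))
  ≡ ∑ xs (λ x → ∑ ys (b x)) - r * ∑ xs (λ x → ∑ ys (c x))
∑∑-affine xs ys b c r = begin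
  ∑ xs (λ x → ∑ ys (λ y → b x y - r * c x y))
    ≡⟨ ∑-cong xs (λ x → trans
         (∑-cong ys (λ y → solve 3 (λ b c r → b :- r :* c := :- r :* c :+ b) refl (b x y) (c x y) r))
         (∑-axpy ys (- r) (c x) (b x))) ⟩
  ∑ xs (λ x → - r * ∑ ys (c x) + ∑ ys (b x))
    ≡⟨ ∑-axpy xs (- r) (λ x → ∑ ys (c x)) (λ x → ∑ ys (b x)) ⟩
  - r * ∑ xs (λ x → ∑ ys (c x)) + ∑ xs (λ x → ∑ ys (b x))
    ≡⟨ solve 3 (λ r c b → :- r :* c :+ b := b :- r :* c) refl r _ _ ⟩
  ∑ xs (λ x → ∑ ys (b x)) - r * ∑ xs (λ x → ∑ ys (c x)) ∎
  where open ≡-Reasoning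

∑∑-difference² : {X Y : Set} (xs : List X) (ys : List Y) (g : X → ℚ) (h : Y → ℚ) →
  ∑ xs (λ x → ∑ ys (λ y → (g x - h y) * (g x - h y)))
  ≡ ∑ ys (λ _ → 1ℚ) * ∑ xs (λ x → g x * g x) - 2ℚ * (∑ xs g * ∑ ys h) + ∑ xs (λ _ → 1ℚ) * ∑ ys (λ y → h y * h y)
∑∑-difference² xs ys g h = begin
  ∑ xs (λ x → ∑ ys (λ y → (g x - h y) * (g x - h y)))
    ≡⟨ ∑-cong xs (λ x → trans
         (∑-cong ys (λ y → solve 2 (λ g h → (g :- h) :* (g :- h)
             := (g :* g) :* con 1ℚ :+ (:- (con 2ℚ :* g) :* h :+ (con 1ℚ :* (h :* h) :+ con 0ℚ))) refl (g x) (h y)))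
         (trans (∑-lin ys ((g x * g x , λ _ → 1ℚ) ∷ (- (2ℚ * g x) , h) ∷ (1ℚ , λ y → h y * h y) ∷ []))
           (solve 5 (λ g² g n H H² → g² :* n :+ (:- (con 2ℚ :* g) :* H :+ (con 1ℚ :* H² :+ con 0ℚ))
             := n :* g² :+ (:- (con 2ℚ :* H) :* g :+ (H² :* con 1ℚ :+ con 0ℚ))) refl (g x * g x) (g x) n H H²))) ⟩
  ∑ xs (lin ((n , λ x → g x * g x) ∷ (- (2ℚ * H) , g) ∷ (H² , λ _ → 1ℚ) ∷ []))
    ≡⟨ ∑-lin xs ((n , λ x → g x * g x) ∷ (- (2ℚ * H) , g) ∷ (H² , λ _ → 1ℚ) ∷ []) ⟩
  n * G² + (- (2ℚ * H) * G + (H² * k + 0ℚ))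
    ≡⟨ solve 6 (λ n G² H G H² k → n :* G² :+ (:- (con 2ℚ :* H) :* G :+ (H² :* k :+ con 0ℚ))
         := n :* G² :- con 2ℚ :* (G :* H) :+ k :* H²) refl n G² H G H² k ⟩
  n * G² - 2ℚ * (G * H) + k * H² ∎
  where
  open ≡-Reasoning
  n k G G² H H² : ℚ
  n = ∑ ys (λ _ → 1ℚ)
  k = ∑ xs (λ _ → 1ℚ)
  G = ∑ xs g
  G² = ∑ xs (λ x → g x * g x)
  H = ∑ ys h
  H² = ∑ ys (λ y → h y * h y)

module Totals {A : Set} (vs : List A) (t s : A) (ρ : A → A → ℚ) where

  number leanSum lean²Sum endSum total : ℚ
  number   = ∑ vs (λ _ → 1ℚ)
  leanSum  = ∑ vs (λ u → ρ t u - ρ s u)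
  lean²Sum = ∑ vs (λ u → (ρ t u - ρ s u) * (ρ t u - ρ s u))
  endSum   = ∑ vs (λ u → ρ t u + ρ s u)
  total    = ∑ vs (λ u → ∑ vs (ρ u))

module Growth {A : Set} (vs : List A) (t s : A) (ρ : A → A → ℚ) (x : Added) (D i : ℚ)
  {k k₂ k₃ k₄ : ℚ} (E : EarSums x k k₂ k₃ k₄) (Di≡1 : D * i ≡ 1ℚ) where
  open Attach t s ρ x D i
  open EarSums E
  open Totals vs t s ρ renaming (number to n; leanSum to P; lean²Sum to Q; endSum to S; total to T)

  ∑⁺ : (Ear x ⊎ A → ℚ) → ℚ
  ∑⁺ f = ∑ (ears x) (λ e → f (inj₁ e)) + ∑ vs (λ u → f (inj₂ u))

  t⁺ s⁺ : Ear x ⊎ A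
  t⁺ = inj₁ (top zero)
  s⁺ = inj₁ (bottom zero)

  m X : ℚ
  m = (n + k) - D
  X = d * (d * m) - 2ℚ * (d * P)

  private
    cancel : ∀ a b → a + (D * i - 1ℚ) * b ≡ a
    cancel a b = trans (cong (λ z → a + (z - 1ℚ) * b) Di≡1)
      (solve 2 (λ a b → a :+ (con 1ℚ :- con 1ℚ) :* b := a) refl a b)

    difference : ∀ B B′ g →
      (B - r * ((coordᵗ 0 - g) * (coordᵗ 0 - g))) - (B′ - r * ((coordᵇ 0 - g) * (coordᵇ 0 - g)))
      ≡ (B - B′) + (g - d) * i
    difference B B′ g = solve 5 (λ B B′ g i d →
        (B :- (con ¼ :* i) :* ((((d :+ con 1ℚ) :+ con 2ℚ :* con 0ℚ) :- g) :* (((d :+ con 1ℚ) :+ con 2ℚ :* con 0ℚ) :- g)))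
          :- (B′ :- (con ¼ :* i) :* ((((d :- con 1ℚ) :- con 2ℚ :* con 0ℚ) :- g) :* (((d :- con 1ℚ) :- con 2ℚ :* con 0ℚ) :- g)))
        := (B :- B′) :+ (g :- d) :* i) refl B B′ g i d

    addition : ∀ B B′ g →
      (B - r * ((coordᵗ 0 - g) * (coordᵗ 0 - g))) + (B′ - r * ((coordᵇ 0 - g) * (coordᵇ 0 - g)))
      ≡ (B + B′) - ½ * i * ((g - d) * (g - d) + 1ℚ)
    addition B B′ g = solve 5 (λ B B′ g i d →
        (B :- (con ¼ :* i) :* ((((d :+ con 1ℚ) :+ con 2ℚ :* con 0ℚ) :- g) :* (((d :+ con 1ℚ) :+ con 2ℚ :* con 0ℚ) :- g)))
          :+ (B′ :- (con ¼ :* i) :* ((((d :- con 1ℚ) :- con 2ℚ :* con 0ℚ) :- g) :* (((d :- con 1ℚ) :- con 2ℚ :* con 0ℚ) :- g)))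
        := (B :+ B′) :- con ½ :* i :* ((g :- d) :* (g :- d) :+ con 1ℚ)) refl B B′ g i d

  lean⁺ : Ear x ⊎ A → ℚ
  lean⁺ z = ρ⁺ t⁺ z - ρ⁺ s⁺ z

  lean⁺-ear : ∀ e → lean⁺ (inj₁ e) ≡ side e + (place e - d) * i
  lean⁺-ear e = difference (gap (top zero) e) (gap (bottom zero) e) (place e)

  lean⁺-old : ∀ u → lean⁺ (inj₂ u) ≡ (lean u - d) * i
  lean⁺-old u = trans (difference (mean u) (mean u) (lean u))
    (solve 2 (λ a b → (a :- a) :+ b := b) refl (mean u) ((lean u - d) * i))

  -- The sides add up to `d`, which is `d * (D * i)`; this is the origin of the `- D` in `m`. In the
  -- next two sums the terms ½ d² of `EarSums` lead to it in the same way.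
  ∑lean⁺ : ∑⁺ lean⁺ ≡ i * (P - d * m)
  ∑lean⁺ = begin
    ∑⁺ lean⁺
      ≡⟨ cong₂ _+_
           (∑-cong (ears x) (λ e → trans (lean⁺-ear e)
             (solve 4 (λ ε q d i → ε :+ (q :- d) :* i
                := con 1ℚ :* ε :+ (i :* q :+ (:- (d :* i) :* con 1ℚ :+ con 0ℚ))) refl (side e) (place e) d i)))
           (∑-cong vs (λ u → trans (lean⁺-old u)
             (solve 3 (λ p d i → (p :- d) :* i := i :* p :+ (:- (d :* i) :* con 1ℚ :+ con 0ℚ)) refl (lean u) d i))) ⟩
    ∑ (ears x) (lin ((1ℚ , side) ∷ (i , place) ∷ (- (d * i) , λ _ → 1ℚ) ∷ []))
      + ∑ vs (lin ((i , lean) ∷ (- (d * i) , λ _ → 1ℚ) ∷ []))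
      ≡⟨ cong₂ _+_ (∑-lin (ears x) ((1ℚ , side) ∷ (i , place) ∷ (- (d * i) , λ _ → 1ℚ) ∷ []))
           (∑-lin vs ((i , lean) ∷ (- (d * i) , λ _ → 1ℚ) ∷ [])) ⟩
    (1ℚ * ∑ (ears x) side + (i * ∑ (ears x) place + (- (d * i) * ∑ (ears x) (λ _ → 1ℚ) + 0ℚ))) + rest
      ≡⟨ cong (_+ rest) (cong₂ (λ a b → 1ℚ * a + b) ∑-side
           (cong₂ (λ a b → i * a + (- (d * i) * b + 0ℚ)) ∑-place ∑-1)) ⟩
    (1ℚ * d + (i * 0ℚ + (- (d * i) * k + 0ℚ))) + rest
      ≡⟨ solve 6 (λ d i k P n D →
           (con 1ℚ :* d :+ (i :* con 0ℚ :+ (:- (d :* i) :* k :+ con 0ℚ))) :+ (i :* P :+ (:- (d :* i) :* n :+ con 0ℚ))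
           := i :* (P :- d :* ((n :+ k) :- D)) :+ (D :* i :- con 1ℚ) :* (:- d)) refl d i k P n D ⟩
    i * (P - d * m) + (D * i - 1ℚ) * (- d)
      ≡⟨ cancel (i * (P - d * m)) (- d) ⟩
    i * (P - d * m) ∎
    where
    open ≡-Reasoning
    rest : ℚ
    rest = i * P + (- (d * i) * n + 0ℚ)

  ∑lean²⁺ : ∑⁺ (λ z → lean⁺ z * lean⁺ z) ≡ i * i * (Q + X) + (k - 2ℚ * (k₃ * i) + k₂ * (i * i))
  ∑lean²⁺ = begin
    ∑⁺ (λ z → lean⁺ z * lean⁺ z)
      ≡⟨ cong₂ _+_
           (∑-cong (ears x) (λ e → trans (cong (λ z → z * z) (lean⁺-ear e))
             (solve 4 (λ ε q d i → (ε :+ (q :- d) :* i) :* (ε :+ (q :- d) :* i)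
                := con 1ℚ :* (ε :* ε) :+ (con 2ℚ :* i :* (ε :* q) :+ (:- (con 2ℚ :* (d :* i)) :* ε
                   :+ (i :* i :* (q :* q) :+ (:- (con 2ℚ :* (d :* (i :* i))) :* q
                   :+ (d :* d :* (i :* i) :* con 1ℚ :+ con 0ℚ)))))) refl (side e) (place e) d i)))
           (∑-cong vs (λ u → trans (cong (λ z → z * z) (lean⁺-old u))
             (solve 3 (λ p d i → ((p :- d) :* i) :* ((p :- d) :* i)
                := i :* i :* (p :* p) :+ (:- (con 2ℚ :* (d :* (i :* i))) :* p
                   :+ (d :* d :* (i :* i) :* con 1ℚ :+ con 0ℚ))) refl (lean u) d i))) ⟩
    ∑ (ears x) (lin cs) + ∑ vs (lin ds)
      ≡⟨ cong₂ _+_ (∑-lin (ears x) cs) (∑-lin vs ds) ⟩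
    linOf (∑ (ears x)) cs + rest
      ≡⟨ cong (_+ rest) (cong₂ (λ a b → 1ℚ * a + b) ∑-side² (cong₂ (λ a b → 2ℚ * i * a + b) ∑-sideplace
           (cong₂ (λ a b → - (2ℚ * (d * i)) * a + b) ∑-side (cong₂ (λ a b → i * i * a + b) ∑-place²
           (cong₂ (λ a b → - (2ℚ * (d * (i * i))) * a + (d * d * (i * i) * b + 0ℚ)) ∑-place ∑-1))))) ⟩
    (1ℚ * k + (2ℚ * i * (½ * (d * d) - k₃) + (- (2ℚ * (d * i)) * d + (i * i * k₂
      + (- (2ℚ * (d * (i * i))) * 0ℚ + (d * d * (i * i) * k + 0ℚ)))))) + rest
      ≡⟨ solve 9 (λ d i k P n D Q k₂ k₃ →
           (con 1ℚ :* k :+ (con 2ℚ :* i :* (con ½ :* (d :* d) :- k₃) :+ (:- (con 2ℚ :* (d :* i)) :* d :+ (i :* i :* k₂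
             :+ (:- (con 2ℚ :* (d :* (i :* i))) :* con 0ℚ :+ (d :* d :* (i :* i) :* k :+ con 0ℚ))))))
             :+ (i :* i :* Q :+ (:- (con 2ℚ :* (d :* (i :* i))) :* P :+ (d :* d :* (i :* i) :* n :+ con 0ℚ)))
           := (i :* i :* (Q :+ (d :* (d :* ((n :+ k) :- D)) :- con 2ℚ :* (d :* P)))
                :+ (k :- con 2ℚ :* (k₃ :* i) :+ k₂ :* (i :* i)))
              :+ (D :* i :- con 1ℚ) :* (d :* d :* i)) refl d i k P n D Q k₂ k₃ ⟩
    (i * i * (Q + X) + (k - 2ℚ * (k₃ * i) + k₂ * (i * i))) + (D * i - 1ℚ) * (d * d * i)
      ≡⟨ cancel (i * i * (Q + X) + (k - 2ℚ * (k₃ * i) + k₂ * (i * i))) (d * d * i) ⟩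
    i * i * (Q + X) + (k - 2ℚ * (k₃ * i) + k₂ * (i * i)) ∎
    where
    open ≡-Reasoning
    cs : List (ℚ × (Ear x → ℚ))
    cs = (1ℚ , λ e → side e * side e) ∷ (2ℚ * i , λ e → side e * place e) ∷ (- (2ℚ * (d * i)) , side)
         ∷ (i * i , λ e → place e * place e) ∷ (- (2ℚ * (d * (i * i))) , place) ∷ (d * d * (i * i) , λ _ → 1ℚ) ∷ []
    ds : List (ℚ × (A → ℚ))
    ds = (i * i , λ u → lean u * lean u) ∷ (- (2ℚ * (d * (i * i))) , lean) ∷ (d * d * (i * i) , λ _ → 1ℚ) ∷ []
    rest : ℚ
    rest = i * i * Q + (- (2ℚ * (d * (i * i))) * P + (d * d * (i * i) * n + 0ℚ))

  ∑ends⁺ : ∑⁺ (λ z → ρ⁺ t⁺ z + ρ⁺ s⁺ z)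
    ≡ - (½ * i) * (Q + X) + (S + ((n * (M - ½ * D - ½ * i) + k₃) - ½ * i * (k₂ + k)))
  ∑ends⁺ = begin
    ∑⁺ (λ z → ρ⁺ t⁺ z + ρ⁺ s⁺ z)
      ≡⟨ cong₂ _+_
           (∑-cong (ears x) (λ e → trans (addition (gap (top zero) e) (gap (bottom zero) e) (place e))
             (solve 4 (λ w q d i → w :- con ½ :* i :* ((q :- d) :* (q :- d) :+ con 1ℚ)
                := con 1ℚ :* w :+ (:- (con ½ :* i) :* (q :* q) :+ (i :* d :* q
                   :+ (:- (con ½ :* i :* (d :* d :+ con 1ℚ)) :* con 1ℚ :+ con 0ℚ)))) refl (reach e) (place e) d i)))
           (∑-cong vs (λ u → trans (addition (mean u) (mean u) (lean u))
             (solve 7 (λ a b p d i M D →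
                ((con ½ :* (a :+ b) :+ (con ½ :* M :- con ¼ :* D)) :+ (con ½ :* (a :+ b) :+ (con ½ :* M :- con ¼ :* D)))
                  :- con ½ :* i :* ((p :- d) :* (p :- d) :+ con 1ℚ)
                := con 1ℚ :* (a :+ b) :+ (:- (con ½ :* i) :* (p :* p) :+ (i :* d :* p
                   :+ (((M :- con ½ :* D) :- con ½ :* i :* (d :* d :+ con 1ℚ)) :* con 1ℚ :+ con 0ℚ)))) refl
                (ρ t u) (ρ s u) (lean u) d i M D))) ⟩
    ∑ (ears x) (lin cs) + ∑ vs (lin ds)
      ≡⟨ cong₂ _+_ (∑-lin (ears x) cs) (∑-lin vs ds) ⟩
    linOf (∑ (ears x)) cs + rest
      ≡⟨ cong (_+ rest) (cong₂ (λ a b → 1ℚ * a + b) ∑-reach (cong₂ (λ a b → - (½ * i) * a + b) ∑-place²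
           (cong₂ (λ a b → i * d * a + (- (½ * i * (d * d + 1ℚ)) * b + 0ℚ)) ∑-place ∑-1))) ⟩
    (1ℚ * (½ * (d * d) + k₃) + (- (½ * i) * k₂ + (i * d * 0ℚ + (- (½ * i * (d * d + 1ℚ)) * k + 0ℚ)))) + rest
      ≡⟨ solve 11 (λ d i k P n D Q k₂ k₃ S M →
           (con 1ℚ :* (con ½ :* (d :* d) :+ k₃) :+ (:- (con ½ :* i) :* k₂ :+ (i :* d :* con 0ℚ
             :+ (:- (con ½ :* i :* (d :* d :+ con 1ℚ)) :* k :+ con 0ℚ))))
             :+ (con 1ℚ :* S :+ (:- (con ½ :* i) :* Q :+ (i :* d :* P
                :+ (((M :- con ½ :* D) :- con ½ :* i :* (d :* d :+ con 1ℚ)) :* n :+ con 0ℚ))))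
           := (:- (con ½ :* i) :* (Q :+ (d :* (d :* ((n :+ k) :- D)) :- con 2ℚ :* (d :* P)))
                :+ (S :+ ((n :* (M :- con ½ :* D :- con ½ :* i) :+ k₃) :- con ½ :* i :* (k₂ :+ k))))
              :+ (D :* i :- con 1ℚ) :* (:- (con ½ :* (d :* d)))) refl d i k P n D Q k₂ k₃ S M ⟩
    (- (½ * i) * (Q + X) + (S + ((n * (M - ½ * D - ½ * i) + k₃) - ½ * i * (k₂ + k))))
      + (D * i - 1ℚ) * (- (½ * (d * d)))
      ≡⟨ cancel (- (½ * i) * (Q + X) + (S + ((n * (M - ½ * D - ½ * i) + k₃) - ½ * i * (k₂ + k)))) (- (½ * (d * d))) ⟩
    - (½ * i) * (Q + X) + (S + ((n * (M - ½ * D - ½ * i) + k₃) - ½ * i * (k₂ + k))) ∎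
    where
    open ≡-Reasoning
    cs : List (ℚ × (Ear x → ℚ))
    cs = (1ℚ , reach) ∷ (- (½ * i) , λ e → place e * place e) ∷ (i * d , place)
         ∷ (- (½ * i * (d * d + 1ℚ)) , λ _ → 1ℚ) ∷ []
    ds : List (ℚ × (A → ℚ))
    ds = (1ℚ , λ u → ρ t u + ρ s u) ∷ (- (½ * i) , λ u → lean u * lean u) ∷ (i * d , lean)
         ∷ ((M - ½ * D) - ½ * i * (d * d + 1ℚ) , λ _ → 1ℚ) ∷ []
    rest : ℚ
    rest = 1ℚ * S + (- (½ * i) * Q + (i * d * P + (((M - ½ * D) - ½ * i * (d * d + 1ℚ)) * n + 0ℚ)))

  private
    ∑-scaled : {B : Set} (xs : List B) (c : ℚ) → ∑ xs (λ _ → c) ≡ c * ∑ xs (λ _ → 1ℚ)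
    ∑-scaled xs c = trans
      (∑-cong xs (λ _ → solve 1 (λ c → c := c :* con 1ℚ :+ con 0ℚ) refl c))
      (trans (∑-lin xs ((c , λ _ → 1ℚ) ∷ []))
        (solve 2 (λ c n → c :* n :+ con 0ℚ := c :* n) refl c (∑ xs (λ _ → 1ℚ))))

    ∑mean : ∑ vs mean ≡ ½ * S + (½ * M - ¼ * D) * n
    ∑mean = trans
      (∑-cong vs (λ u → solve 2 (λ a c → con ½ :* a :+ c := con ½ :* a :+ (c :* con 1ℚ :+ con 0ℚ)) refl
        (ρ t u + ρ s u) (½ * M - ¼ * D)))
      (trans (∑-lin vs ((½ , λ u → ρ t u + ρ s u) ∷ (½ * M - ¼ * D , λ _ → 1ℚ) ∷ []))
        (solve 3 (λ a c n → a :+ (c :* n :+ con 0ℚ) := a :+ c :* n) refl (½ * S) (½ * M - ¼ * D) n))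

    ear-ear : ∑ (ears x) (λ e → ∑ (ears x) (λ e′ → ρ⁺ (inj₁ e) (inj₁ e′))) ≡ k₄ - r * (2ℚ * (k * k₂))
    ear-ear = trans (∑∑-affine (ears x) (ears x) gap (λ e e′ → (place e - place e′) * (place e - place e′)) r)
      (cong₂ (λ a b → a - r * b) ∑-gap (trans (∑∑-difference² (ears x) (ears x) place place)
        (trans (cong₂ (λ a b → a - b + ∑ (ears x) (λ _ → 1ℚ) * ∑ (ears x) (λ e → place e * place e))
                 (cong₂ _*_ ∑-1 ∑-place²) (cong (λ a → 2ℚ * (a * a)) ∑-place))
        (trans (cong (λ a → k * k₂ - 2ℚ * (0ℚ * 0ℚ) + a) (cong₂ _*_ ∑-1 ∑-place²))
          (solve 1 (λ a → a :- con 2ℚ :* (con 0ℚ :* con 0ℚ) :+ a := con 2ℚ :* a) refl (k * k₂))))))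

    ear-old : ∑ (ears x) (λ e → ∑ vs (λ u → ρ⁺ (inj₁ e) (inj₂ u)))
      ≡ k * (½ * S + (½ * M - ¼ * D) * n) - r * (n * k₂ + k * Q)
    ear-old = trans (∑∑-affine (ears x) vs (λ _ → mean) (λ e u → (place e - lean u) * (place e - lean u)) r)
      (cong₂ (λ a b → a - r * b)
        (trans (∑-scaled (ears x) (∑ vs mean)) (trans (*-comm (∑ vs mean) _) (cong₂ _*_ ∑-1 ∑mean)))
        (trans (∑∑-difference² (ears x) vs place lean)
        (trans (cong₂ (λ a b → n * a - 2ℚ * (b * P) + ∑ (ears x) (λ _ → 1ℚ) * Q) ∑-place² ∑-place)
        (trans (cong (λ a → n * k₂ - 2ℚ * (0ℚ * P) + a * Q) ∑-1)
          (solve 3 (λ a P b → a :- con 2ℚ :* (con 0ℚ :* P) :+ b := a :+ b) refl (n * k₂) P (k * Q))))))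

    old-ear : ∑ vs (λ u → ∑ (ears x) (λ e → ρ⁺ (inj₂ u) (inj₁ e)))
      ≡ k * (½ * S + (½ * M - ¼ * D) * n) - r * (n * k₂ + k * Q)
    old-ear = trans (∑-swap vs (ears x) (λ u e → ρ⁺ (inj₂ u) (inj₁ e)))
      (trans (∑-cong (ears x) (λ e → ∑-cong vs (λ u → cong (λ z → mean u - r * z)
        (solve 2 (λ a b → (a :- b) :* (a :- b) := (b :- a) :* (b :- a)) refl (lean u) (place e))))) ear-old)

    old-old : ∑ vs (λ u → ∑ vs (λ v → ρ⁺ (inj₂ u) (inj₂ v))) ≡ T - r * (2ℚ * (n * Q - P * P))
    old-old = trans (∑∑-affine vs vs ρ (λ u v → (lean u - lean v) * (lean u - lean v)) r)
      (cong (λ b → T - r * b) (trans (∑∑-difference² vs vs lean lean)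
        (solve 2 (λ a P → a :- con 2ℚ :* (P :* P) :+ a := con 2ℚ :* (a :- P :* P)) refl (n * Q) P)))

  -- No `d` occurs: the places sum to zero, which removes their product with `P`, and the remaining
  -- sums over the ear are the same in all orientations.
  ∑∑ρ⁺ : ∑⁺ (λ y → ∑⁺ (ρ⁺ y))
    ≡ - (½ * i) * ((n * Q - P * P) + k * Q)
      + ((T + k * S) + (k₄ - ½ * i * (k * k₂) + (k * ((M - ½ * D) * n) - ½ * i * (n * k₂))))
  ∑∑ρ⁺ = begin
    ∑⁺ (λ y → ∑⁺ (ρ⁺ y))
      ≡⟨ cong₂ _+_
           (∑-+ (ears x) (λ e → ∑ (ears x) (λ e′ → ρ⁺ (inj₁ e) (inj₁ e′))) (λ e → ∑ vs (λ u → ρ⁺ (inj₁ e) (inj₂ u))))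
           (∑-+ vs (λ u → ∑ (ears x) (λ e → ρ⁺ (inj₂ u) (inj₁ e))) (λ u → ∑ vs (λ v → ρ⁺ (inj₂ u) (inj₂ v)))) ⟩
    _ ≡⟨ cong₂ _+_ (cong₂ _+_ ear-ear ear-old) (cong₂ _+_ old-ear old-old) ⟩
    _ ≡⟨ solve 11 (λ i k P n D Q k₂ k₄ S M T →
           ((k₄ :- (con ¼ :* i) :* (con 2ℚ :* (k :* k₂)))
             :+ (k :* (con ½ :* S :+ (con ½ :* M :- con ¼ :* D) :* n) :- (con ¼ :* i) :* (n :* k₂ :+ k :* Q)))
           :+ ((k :* (con ½ :* S :+ (con ½ :* M :- con ¼ :* D) :* n) :- (con ¼ :* i) :* (n :* k₂ :+ k :* Q))
             :+ (T :- (con ¼ :* i) :* (con 2ℚ :* (n :* Q :- P :* P))))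
           := :- (con ½ :* i) :* ((n :* Q :- P :* P) :+ k :* Q)
              :+ ((T :+ k :* S) :+ (k₄ :- con ½ :* i :* (k :* k₂) :+ (k :* ((M :- con ½ :* D) :* n) :- con ½ :* i :* (n :* k₂)))))
           refl i k P n D Q k₂ k₄ S M T ⟩
    _ ∎
    where open ≡-Reasoning

-- The recursion on profiles and its monotonicity.

-- The number of vertices, ∑ p, ∑ p², ∑ (ρ t + ρ s) and the double sum of ρ; V
-- is half the double sum of (p u − p v)².
record Profile : Set where
  constructor profile
  field
    n P Q S T : ℚ

  V : ℚ
  V = n * Q - P * P

profile-cong : ∀ {n n′ P P′ Q Q′ S S′ T T′} → n ≡ n′ → P ≡ P′ → Q ≡ Q′ → S ≡ S′ → T ≡ T′ →
               profile n P Q S T ≡ profile n′ P′ Q′ S′ T′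
profile-cong refl refl refl refl refl = refl

module Grow (k k₂ k₃ k₄ M D i d : ℚ) (p : Profile) where
  open Profile p

  m X : ℚ
  m = (n + k) - D
  X = d * (d * m) - 2ℚ * (d * P)

  grow : Profile
  grow = profile (n + k) (i * (P - d * m))
    (i * i * (Q + X) + (k - 2ℚ * (k₃ * i) + k₂ * (i * i)))
    (- (½ * i) * (Q + X) + (S + ((n * (M - ½ * D - ½ * i) + k₃) - ½ * i * (k₂ + k))))
    (- (½ * i) * (V + k * Q)
      + ((T + k * S) + (k₄ - ½ * i * (k * k₂) + (k * ((M - ½ * D) * n) - ½ * i * (n * k₂)))))

  -- Since (P - d m)² = P² + m X, the coefficient of `X` drops from n + k to n + k - m = D, and i² D
  -- = i. The old `V` reappears whole, so no separate bound on P² is called for.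
  grow-V : D * i ≡ 1ℚ →
    Profile.V grow ≡ i * i * (V + k * Q) + (i * X + (n + k) * (k - 2ℚ * (k₃ * i) + k₂ * (i * i)))
  grow-V Di≡1 = trans
    (solve 8 (λ n k i Q P d D c →
        (n :+ k) :* (i :* i :* (Q :+ (d :* (d :* ((n :+ k) :- D)) :- con 2ℚ :* (d :* P))) :+ c)
          :- (i :* (P :- d :* ((n :+ k) :- D))) :* (i :* (P :- d :* ((n :+ k) :- D)))
        := (i :* i :* ((n :* Q :- P :* P) :+ k :* Q)
             :+ (i :* (d :* (d :* ((n :+ k) :- D)) :- con 2ℚ :* (d :* P)) :+ (n :+ k) :* c))
           :+ (D :* i :- con 1ℚ) :* (i :* (d :* (d :* ((n :+ k) :- D)) :- con 2ℚ :* (d :* P)))) refl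
      n k i Q P d D c)
    (trans (cong (λ z → (i * i * (V + k * Q) + (i * X + (n + k) * c)) + (z - 1ℚ) * (i * X)) Di≡1)
      (solve 2 (λ a b → a :+ (con 1ℚ :- con 1ℚ) :* b := a) refl
        (i * i * (V + k * Q) + (i * X + (n + k) * c)) (i * X)))
    where
    c : ℚ
    c = k - 2ℚ * (k₃ * i) + k₂ * (i * i)

open Grow using (grow; grow-V)

-- Reflecting a chain top to bottom negates `P` and keeps everything else, so only the absolute
-- value of `P` can be compared: the two bounds say that it is at most -P₀. `Q` and `V` are ordered
-- against `S` and `T` because they enter the latter with negative coefficients.
record _⊑_ (p₀ p : Profile) : Set where
  private
    module p₀ = Profile p₀
    module p = Profile p
  field
    n≡    : p₀.n ≡ p.n
    P₀≤P  : p₀.P ≤ p.P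
    P≤-P₀ : p.P ≤ - p₀.P
    Q≤Q₀  : p.Q ≤ p₀.Q
    V≤V₀  : p.V ≤ p₀.V
    S₀≤S  : p₀.S ≤ p.S
    T₀≤T  : p₀.T ≤ p.T

*-mono-≤-nonNegˡ : ∀ {c a b} → 0ℚ ≤ c → a ≤ b → c * a ≤ c * b
*-mono-≤-nonNegˡ {c} 0≤c = *-monoˡ-≤-nonNeg c {{nonNegative 0≤c}}

0≤* : ∀ {a b} → 0ℚ ≤ a → 0ℚ ≤ b → 0ℚ ≤ a * b
0≤* {a} {b} 0≤a 0≤b = subst (_≤ a * b) (*-zeroʳ a) (*-mono-≤-nonNegˡ 0≤a 0≤b)

*+-mono-≤ : ∀ {c a b e f} → 0ℚ ≤ c → a ≤ b → e ≤ f → c * a + e ≤ c * b + f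
*+-mono-≤ 0≤c a≤b e≤f = +-mono-≤ (*-mono-≤-nonNegˡ 0≤c a≤b) e≤f

neg*+-mono-≤ : ∀ {c a b e f} → 0ℚ ≤ c → a ≤ b → e ≤ f → - c * b + e ≤ - c * a + f
neg*+-mono-≤ {c} {a} {b} 0≤c a≤b e≤f = +-mono-≤
  (subst₂ _≤_ (neg-distribˡ-* c b) (neg-distribˡ-* c a) (neg-antimono-≤ (*-mono-≤-nonNegˡ 0≤c a≤b))) e≤f

-- The possible values of d for the polygons of a chain, when d₀ is that of
-- the polygon at the same place of the helicene.
data _≼±_ (d d₀ : ℚ) : Set where
  same : d ≡ d₀ → d ≼± d₀
  none : d ≡ 0ℚ → d ≼± d₀
  flip : d ≡ - d₀ → d ≼± d₀

d*-≤ : ∀ {d d₀ m} → d ≼± d₀ → 0ℚ ≤ d₀ → 0ℚ ≤ m → d * m ≤ d₀ * m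
d*-≤               (same refl) 0≤d₀ 0≤m = ≤-refl
d*-≤ {_} {d₀} {m}  (none refl) 0≤d₀ 0≤m = subst (_≤ d₀ * m) (sym (*-zeroˡ m)) (0≤* 0≤d₀ 0≤m)
d*-≤ {_} {d₀} {m}  (flip refl) 0≤d₀ 0≤m =
  ≤-trans (subst (_≤ 0ℚ) (neg-distribˡ-* d₀ m) (neg-antimono-≤ (0≤* 0≤d₀ 0≤m))) (0≤* 0≤d₀ 0≤m)

-d*-≤ : ∀ {d d₀ m} → d ≼± d₀ → 0ℚ ≤ d₀ → 0ℚ ≤ m → - (d * m) ≤ d₀ * m
-d*-≤              (same refl) 0≤d₀ 0≤m = ≤-trans (neg-antimono-≤ (0≤* 0≤d₀ 0≤m)) (0≤* 0≤d₀ 0≤m)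
-d*-≤ {_} {d₀} {m} (none refl) 0≤d₀ 0≤m = subst (_≤ d₀ * m) (cong -_ (sym (*-zeroˡ m))) (0≤* 0≤d₀ 0≤m)
-d*-≤ {_} {d₀} {m} (flip refl) 0≤d₀ 0≤m = ≤-reflexive (solve 2 (λ d m → :- (:- d :* m) := d :* m) refl d₀ m)

d²*-≤ : ∀ {d d₀ m} → d ≼± d₀ → 0ℚ ≤ d₀ → 0ℚ ≤ m → d * (d * m) ≤ d₀ * (d₀ * m)
d²*-≤              (same refl) 0≤d₀ 0≤m = ≤-refl
d²*-≤ {_} {d₀} {m} (none refl) 0≤d₀ 0≤m =
  subst (_≤ d₀ * (d₀ * m)) (sym (*-zeroˡ (0ℚ * m))) (0≤* 0≤d₀ (0≤* 0≤d₀ 0≤m))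
d²*-≤ {_} {d₀} {m} (flip refl) 0≤d₀ 0≤m =
  ≤-reflexive (solve 2 (λ d m → :- d :* (:- d :* m) := d :* (d :* m)) refl d₀ m)

p≤-p⇒p≤0 : ∀ p → p ≤ - p → p ≤ 0ℚ
p≤-p⇒p≤0 p p≤-p = subst₂ _≤_ (solve 1 (λ p → con ½ :* (p :+ p) := p) refl p) (*-zeroʳ ½)
  (*-mono-≤-nonNegˡ {½} (nonNegative⁻¹ ½) (subst (p + p ≤_) (+-inverseˡ p) (+-monoˡ-≤ p p≤-p)))

-- The absolute values of `d` and `P` are at most `d₀` and `- P₀`, so `d * P` cannot fall below
-- `d₀ * P₀`. For `d` zero, the sign of `P₀` is read off from its two bounds.
d*P-≥ : ∀ {d d₀ P₀ P} → d ≼± d₀ → 0ℚ ≤ d₀ → P₀ ≤ P → P ≤ - P₀ → d₀ * P₀ ≤ d * P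
d*P-≥                    (same refl) 0≤d₀ P₀≤P P≤-P₀ = *-mono-≤-nonNegˡ 0≤d₀ P₀≤P
d*P-≥ {_} {d₀} {P₀} {P} (none refl) 0≤d₀ P₀≤P P≤-P₀ = subst (d₀ * P₀ ≤_) (trans (*-zeroʳ d₀) (sym (*-zeroˡ P)))
  (*-mono-≤-nonNegˡ 0≤d₀ (p≤-p⇒p≤0 P₀ (≤-trans P₀≤P P≤-P₀)))
d*P-≥ {_} {d₀} {P₀} {P} (flip refl) 0≤d₀ P₀≤P P≤-P₀ = subst₂ _≤_
  (solve 2 (λ d p → d :* (:- (:- p)) := d :* p) refl d₀ P₀)
  (solve 2 (λ d p → d :* (:- p) := :- d :* p) refl d₀ P) (*-mono-≤-nonNegˡ 0≤d₀ (neg-antimono-≤ P≤-P₀))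

-- Quantities already compared occur with coefficients of known sign. The remaining terms, built
-- from n, D, i and the moments of the ear, may have any sign but are common to both sides.
grow-mono : ∀ {k k₂ k₃ k₄ M D i d₀ d p₀ p} → p₀ ⊑ p → d ≼± d₀ → 0ℚ ≤ d₀ → D * i ≡ 1ℚ → 0ℚ ≤ i → 0ℚ ≤ k →
  0ℚ ≤ (Profile.n p + k) - D → grow k k₂ k₃ k₄ M D i d₀ p₀ ⊑ grow k k₂ k₃ k₄ M D i d p
grow-mono {k} {k₂} {k₃} {k₄} {M} {D} {i} {d₀} {d} {profile n P₀ Q₀ S₀ T₀} {profile n P Q S T}
  record { n≡ = refl ; P₀≤P = P₀≤P ; P≤-P₀ = P≤-P₀ ; Q≤Q₀ = Q≤Q₀ ; V≤V₀ = V≤V₀ ; S₀≤S = S₀≤S ; T₀≤T = T₀≤T }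
  d≼d₀ 0≤d₀ Di≡1 0≤i 0≤k 0≤m = record
  { n≡    = refl
  ; P₀≤P  = *-mono-≤-nonNegˡ 0≤i (+-mono-≤ P₀≤P (neg-antimono-≤ (d*-≤ d≼d₀ 0≤d₀ 0≤m)))
  ; P≤-P₀ = subst (i * (P - d * m) ≤_)
      (solve 3 (λ i p q → i :* (:- p :+ q) := :- (i :* (p :- q))) refl i P₀ (d₀ * m))
      (*-mono-≤-nonNegˡ 0≤i (+-mono-≤ P≤-P₀ (-d*-≤ d≼d₀ 0≤d₀ 0≤m)))
  ; Q≤Q₀  = *+-mono-≤ (0≤* 0≤i 0≤i) Q+X≤ ≤-refl
  ; V≤V₀  = subst₂ _≤_ (sym (grow-V k k₂ k₃ k₄ M D i d (profile n P Q S T) Di≡1))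
                       (sym (grow-V k k₂ k₃ k₄ M D i d₀ (profile n P₀ Q₀ S₀ T₀) Di≡1))
      (*+-mono-≤ (0≤* 0≤i 0≤i) V+kQ≤ (*+-mono-≤ 0≤i X≤X₀ ≤-refl))
  ; S₀≤S  = neg*+-mono-≤ 0≤½i Q+X≤ (+-monoˡ-≤ _ S₀≤S)
  ; T₀≤T  = neg*+-mono-≤ 0≤½i V+kQ≤ (+-monoˡ-≤ _ (+-mono-≤ T₀≤T (*-mono-≤-nonNegˡ 0≤k S₀≤S)))
  }
  where
  m : ℚ
  m = (n + k) - D
  0≤½i : 0ℚ ≤ ½ * i
  0≤½i = 0≤* {½} (nonNegative⁻¹ ½) 0≤i
  X≤X₀ : d * (d * m) - 2ℚ * (d * P) ≤ d₀ * (d₀ * m) - 2ℚ * (d₀ * P₀)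
  X≤X₀ = +-mono-≤ (d²*-≤ d≼d₀ 0≤d₀ 0≤m)
    (neg-antimono-≤ (*-mono-≤-nonNegˡ {2ℚ} (nonNegative⁻¹ 2ℚ) (d*P-≥ d≼d₀ 0≤d₀ P₀≤P P≤-P₀)))
  Q+X≤ : Q + (d * (d * m) - 2ℚ * (d * P)) ≤ Q₀ + (d₀ * (d₀ * m) - 2ℚ * (d₀ * P₀))
  Q+X≤ = +-mono-≤ Q≤Q₀ X≤X₀
  V+kQ≤ : (n * Q - P * P) + k * Q ≤ (n * Q₀ - P₀ * P₀) + k * Q₀
  V+kQ≤ = +-mono-≤ V≤V₀ (*-mono-≤-nonNegˡ 0≤k Q≤Q₀)

-- Comparison of chains, polygon by polygon.

chainProfile : ∀ {L} → Vec Added L → Profile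
chainProfile as = profile number leanSum lean²Sum endSum total
  where open Totals (Graph.vertices (chain as)) (endTop as) (endBottom as) (chainρ as)

module _ {L} (x : Added) (as : Vec Added L) {k k₂ k₃ k₄ : ℚ} (E : EarSums x k k₂ k₃ k₄) where
  private
    D i : ℚ
    D = Cycle.D x (endResistance as)
    i = Cycle.i x (endResistance as)
    open Attach (endTop as) (endBottom as) (chainρ as) x D i using (ρ⁺)
    module Gr = Growth (Graph.vertices (chain as)) (endTop as) (endBottom as) (chainρ as) x D i E
                       (Cycle.D*i≡1 x (endResistance as))

    ∑-split⁺ : ∀ f → ∑ (Graph.vertices (chain (x ∷ as))) (λ v → f (split x as v)) ≡ Gr.∑⁺ f
    ∑-split⁺ f = trans (∑-split x as (λ v → f (split x as v)))
      (cong₂ _+_ (∑-cong (ears x) (λ e → cong f (split-join x as (inj₁ e))))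
                 (∑-cong (Graph.vertices (chain as)) (λ u → cong f (split-join x as (inj₂ u)))))

  chainProfile-∷ : chainProfile (x ∷ as) ≡ grow k k₂ k₃ k₄ (EarGeometry.M x) D i (EarGeometry.d x) (chainProfile as)
  chainProfile-∷ = profile-cong
    (trans (∑-split⁺ (λ _ → 1ℚ)) (trans (cong (_+ Profile.n (chainProfile as)) (EarSums.∑-1 E)) (+-comm k _)))
    (trans (∑-split⁺ Gr.lean⁺) Gr.∑lean⁺)
    (trans (∑-split⁺ (λ z → Gr.lean⁺ z * Gr.lean⁺ z)) Gr.∑lean²⁺)
    (trans (∑-split⁺ (λ z → ρ⁺ Gr.t⁺ z + ρ⁺ Gr.s⁺ z)) Gr.∑ends⁺)
    (trans (∑-cong (Graph.vertices (chain (x ∷ as))) (λ u → ∑-split⁺ (ρ⁺ (split x as u))))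
      (trans (∑-split⁺ (λ y → Gr.∑⁺ (ρ⁺ y))) Gr.∑∑ρ⁺))

-- The two reciprocals are formed with different proofs that `D` is nonzero, so they are identified
-- through their defining equation.
inverse-unique : ∀ {D i j} → D * i ≡ 1ℚ → D * j ≡ 1ℚ → i ≡ j
inverse-unique {D} {i} {j} Di≡1 Dj≡1 = begin
  i            ≡⟨ sym (*-identityˡ i) ⟩
  1ℚ * i       ≡⟨ cong (_* i) (sym Dj≡1) ⟩
  (D * j) * i  ≡⟨ solve 3 (λ D i j → (D :* j) :* i := (D :* i) :* j) refl D i j ⟩
  (D * i) * j  ≡⟨ cong (_* j) Di≡1 ⟩
  1ℚ * j       ≡⟨ *-identityˡ j ⟩
  j            ∎
  where open ≡-Reasoning

-- Equal end resistances give the next ears the same `D` and `i`; the bound on the number of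
-- vertices serves the sign of m.
record _≼_ {L} (as₀ as : Vec Added L) : Set where
  field
    R≡  : EndResistance.R (endResistance as₀) ≡ EndResistance.R (endResistance as)
    2≤n : 2ℚ ≤ Profile.n (chainProfile as)
    p₀⊑p : chainProfile as₀ ⊑ chainProfile as

-- The two ends of a single rung have opposite p, so `P` computes to zero and both of its bounds
-- hold with equality.
≼-[] : [] ≼ []
≼-[] = record
  { R≡  = refl
  ; 2≤n = ≤-refl
  ; p₀⊑p = record { n≡ = refl ; P₀≤P = ≤-refl ; P≤-P₀ = ≤-refl ; Q≤Q₀ = ≤-refl ; V≤V₀ = ≤-refl
                 ; S₀≤S = ≤-refl ; T₀≤T = ≤-refl }
  }

≼-∷ : ∀ {L k k₂ k₃ k₄ x₀ x} {as₀ as : Vec Added L} →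
  EarSums x₀ k k₂ k₃ k₄ → EarSums x k k₂ k₃ k₄ → EarGeometry.d x ≼± EarGeometry.d x₀ → 0ℚ ≤ EarGeometry.d x₀ → 0ℚ ≤ k →
  as₀ ≼ as → (x₀ ∷ as₀) ≼ (x ∷ as)
≼-∷ {k = k} {k₂} {k₃} {k₄} {x₀} {x} {as₀} {as} E₀ E d≼d₀ 0≤d₀ 0≤k as₀≼as = record
  { R≡  = cong (λ j → 1ℚ - j) i₀≡i
  ; 2≤n = subst (λ p → 2ℚ ≤ Profile.n p) (sym (chainProfile-∷ x as E))
      (subst (_≤ Profile.n (chainProfile as) + k) (+-identityʳ 2ℚ) (+-mono-≤ 2≤n 0≤k))
  ; p₀⊑p = subst₂ _⊑_
      (sym (trans (chainProfile-∷ x₀ as₀ E₀) (same-cycle (EarGeometry.d x₀) (chainProfile as₀) M₀≡M D₀≡D i₀≡i)))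
      (sym (chainProfile-∷ x as E))
      (grow-mono {k} {k₂} {k₃} {k₄} {EarGeometry.M x} {C.D} {C.i} {EarGeometry.d x₀} {EarGeometry.d x} {chainProfile as₀} {chainProfile as} p₀⊑p d≼d₀ 0≤d₀ C.D*i≡1 C.0≤i 0≤k 0≤m)
  }
  where
  open _≼_ as₀≼as
  module C₀ = Cycle x₀ (endResistance as₀)
  module C = Cycle x (endResistance as)
  R n : ℚ
  R = EndResistance.R (endResistance as)
  n = Profile.n (chainProfile as)

  M₀≡M : EarGeometry.M x₀ ≡ EarGeometry.M x
  M₀≡M = trans (EarSums.M≡s+1 E₀) (sym (EarSums.M≡s+1 E))

  D₀≡D : C₀.D ≡ C.D
  D₀≡D = cong₂ _+_ R≡ M₀≡M

  i₀≡i : C₀.i ≡ C.i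
  i₀≡i = inverse-unique {C₀.D} C₀.D*i≡1 (trans (cong (_* C.i) D₀≡D) C.D*i≡1)

  same-cycle : ∀ d p {M M′ D D′ i i′} → M ≡ M′ → D ≡ D′ → i ≡ i′ →
               grow k k₂ k₃ k₄ M D i d p ≡ grow k k₂ k₃ k₄ M′ D′ i′ d p
  same-cycle d p refl refl refl = refl

  -- With D = R + k + 1, the excess m is (n - 2) + (1 - R).
  0≤m : 0ℚ ≤ (n + k) - C.D
  0≤m = subst (0ℚ ≤_)
    (trans (solve 3 (λ n k R → (n :- con 2ℚ) :+ (con 1ℚ :- R) := (n :+ k) :- (R :+ (k :+ con 1ℚ))) refl n k R)
           (cong (λ M → (n + k) - (R + M)) (sym (EarSums.M≡s+1 E))))
    (+-mono-≤ {0ℚ} {n - 2ℚ} {0ℚ} {1ℚ - R}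
      (subst (_≤ n - 2ℚ) (+-inverseʳ 2ℚ) (+-monoˡ-≤ (- 2ℚ) 2≤n))
      (subst (_≤ 1ℚ - R) (+-inverseʳ R) (+-monoˡ-≤ (- R) (EndResistance.R≤1 (endResistance as)))))

≼-square : ∀ {L} {as₀ as : Vec Added L} → as₀ ≼ as → (unchanged ∷ as₀) ≼ (unchanged ∷ as)
≼-square = ≼-∷ squareSums squareSums (same refl) ≤-refl (nonNegative⁻¹ 2ℚ)

-- The value of `d` is 2, 0 or -2 according to `a`, while the moments of the ear agree.
≼-hexagon : ∀ {L} {as₀ as : Vec Added L} a → as₀ ≼ as → (innerHexagon zero ∷ as₀) ≼ (innerHexagon a ∷ as)
≼-hexagon a = ≼-∷ (hexagonSums zero) (hexagonSums a) (orientation a) (nonNegative⁻¹ 2ℚ) (nonNegative⁻¹ 4ℚ)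
  where
  orientation : ∀ a → EarGeometry.d (innerHexagon a) ≼± EarGeometry.d (innerHexagon zero)
  orientation zero             = same refl
  orientation (suc zero)       = none refl
  orientation (suc (suc zero)) = flip refl

-- `endHexagon` and `innerHexagon zero` are equal by computation, so the last hexagon is a case of
-- the inner ones.
≼-squaresAfterFirst : ∀ {k} (w : Vec (Fin 3) k) → squaresAfterFirst (replicate k zero) ≼ squaresAfterFirst w
≼-squaresAfterFirst []      = ≼-square (≼-hexagon zero ≼-[])
≼-squaresAfterFirst (a ∷ w) = ≼-square (≼-hexagon a (≼-squaresAfterFirst w))

Kf-chain : ∀ {L} (as : Vec Added L) → Kf (chain as) ≡ ½ * Profile.T (chainProfile as)
Kf-chain as = trans (solve 1 (λ a → a := con ½ :* (a :+ a)) refl (Kf (chain as)))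
  (cong (½ *_) (Energy.Kf-double (chain as) (chain-isResistance as)))

≼⇒Kf≤ : ∀ {L} {as₀ as : Vec Added L} → as₀ ≼ as → Kf (chain as₀) ≤ Kf (chain as)
≼⇒Kf≤ {as₀ = as₀} {as} as₀≼as = subst₂ _≤_ (sym (Kf-chain as₀)) (sym (Kf-chain as))
  (*-mono-≤-nonNegˡ {½} (nonNegative⁻¹ ½) (_⊑_.T₀≤T (_≼_.p₀⊑p as₀≼as)))

mainTheorem1 : (n : ℕ) → 2 ℕ≤ n → (w : Vec (Fin 3) (n ∸ 2)) → Kf (helicene n) ≤ Kf (phenyleneChain w)
mainTheorem1 n _ w = ≼⇒Kf≤ {as₀ = squares (replicate (n ∸ 2) zero)} {as = squares w}
  (≼-hexagon zero (≼-squaresAfterFirst w))
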